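{- Let $\mathcal{C}$ be the set of integer partitions in which the difference of any two consecutive (adjacent) parts is at least $2$, and is exactly $2$ or $3$ only if the sum of these two parts is a multiple of $3$. Let $\mathcal{P}_1$ be the set of $\pi\in\mathcal{C}$ in which $1$ does not appear as a part, and let $\mathcal{P}_2$ be the set of $\pi\in\mathcal{C}$ in which $2$ does not appear as a part. Then, as formal power series in $x,q$, $$\sum_{\pi\in\mathcal{P}_1}x^{\ell(\pi)}q^{|\pi|}=\sum_{i,j\ge 0}\frac{x^{i+2j}q^{2i^2+6ij+6j^2}}{(q;q)_i\,(q^3;q^3)_j},$$ and, writing $R=i+j+k+2l$ in the four-fold sum, $$\sum_{\pi\in\mathcal{P}_2}x^{\ell(\pi)}q^{|\pi|}=\sum_{i,j,k,l\ge 0}\frac{x^{R}q^{\frac{3R(R-1)}{2}+3i+5j+\frac{3j(j-1)}{2}+k+\frac{3k(k-1)}{2}+3l}}{(q^3;q^3)_i\,(q^3;q^3)_j\,(q^3;q^3)_k\,(q^6;q^6)_l}$$ $$=\sum_{i,j\ge 0}\frac{x^{i+2j}q^{2i^2+6ij+6j^2+i}}{(q;q)_i\,(q^3;q^3)_j}+\sum_{i,j\ge 0}\frac{x^{i+2j+1}q^{2i^2+6ij+6j^2+4i+6j+1}}{(q;q)_i\,(q^3;q^3)_j}.$$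
   Context: Partitions are finite weakly increasing sequences of positive integers (the empty partition is included); $\ell(\pi)$ is the number of parts and $|\pi|$ the sum of the parts of $\pi$. For $n\ge 0$, $(a;q)_n=\prod_{0\le t<n}(1-aq^t)$. All identities are identities of formal power series. -}

module Defs where

import Algebra.Properties.CommutativeMonoid.Sum
open import Data.Bool.Base using (if_then_else_)
open import Data.Fin.Base using (toℕ)
open import Data.Integer.Base as ℤ using (ℤ; 0ℤ; 1ℤ)
open import Data.Integer.Properties as ℤₚ using ()
open import Data.List.Base as List using (List; length; foldr)
open import Data.List.Membership.Propositional using (_∈_; _∉_)
open import Data.List.Relation.Unary.All using (All)
open import Data.List.Relation.Unary.Linked using (Linked)
open import Data.List.Relation.Unary.Unique.Propositional using (Unique)
open import Data.Nat.Base using (ℕ; zero; suc; _+_; _∸_; _≤_; _<_)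
open import Data.Nat.Divisibility using (_∣_)
open import Data.Nat.ListAction using (sum)
open import Data.Nat.Properties using (_≟_)
open import Data.Product.Base using (Σ-syntax; _×_)
open import Data.Refinement using (Refinement-syntax)
open import Data.Sum.Base using (_⊎_)
open import Relation.Binary.PropositionalEquality
open import Relation.Nullary using (¬_; does)

open Algebra.Properties.CommutativeMonoid.Sum ℤₚ.+-0-commutativeMonoid
  using (sum⁺-syntax)

-- The proofs are irrelevant, so two partitions are equal as soon as their
-- lists of parts are, and a sum over partitions counts each of them once.
record Partition : Set where
  constructor mkPartition
  field
    parts       : List ℕ
    .positive   : All (0 <_) parts
    .increasing : Linked _≤_ parts

open Partition public

ℓ : Partition → ℕ
ℓ π = length (parts π)

∣_∣ₚ : Partition → ℕ
∣ π ∣ₚ = sum (parts π)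

-- a precedes b in a weakly increasing sequence, so b ∸ a is the true difference.
Gap : ℕ → ℕ → Set
Gap a b = 2 ≤ b ∸ a × (b ∸ a ≡ 2 ⊎ b ∸ a ≡ 3 → 3 ∣ a + b)

𝒞 : Partition → Set
𝒞 π = Linked Gap (parts π)

𝒫₁ 𝒫₂ : Set
𝒫₁ = [ π ∈ Partition ∣ (𝒞 π × ¬ (1 ∈ parts π)) ]
𝒫₂ = [ π ∈ Partition ∣ (𝒞 π × ¬ (2 ∈ parts π)) ]

infixr 8 q^_ _^_
infixl 7 _⊗_ _⊘_
infixl 6 _⊖_
infix  9 ⟨_⨾_⟩_
infixr 6 x^_·_

-- A formal power series in q is its sequence of coefficients.
ℤ⟦q⟧ : Set
ℤ⟦q⟧ = ℕ → ℤ

q^_ : ℕ → ℤ⟦q⟧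
(q^ a) n = if does (n ≟ a) then 1ℤ else 0ℤ

_⊖_ : ℤ⟦q⟧ → ℤ⟦q⟧ → ℤ⟦q⟧
(f ⊖ g) n = f n ℤ.- g n

_⊗_ : ℤ⟦q⟧ → ℤ⟦q⟧ → ℤ⟦q⟧
(f ⊗ g) n = ∑[ k ≤ n ] (f (toℕ k) ℤ.* g (n ∸ toℕ k))

_^_ : ℤ⟦q⟧ → ℕ → ℤ⟦q⟧
f ^ zero  = q^ 0
f ^ suc t = f ⊗ f ^ t

-- Long division, for g with constant term 1 (see ⊘-⊗ below): writing
-- f = f₀ + q f′ and g = 1 + q g′, we have f / g = f₀ + q ((f′ - f₀ g′) / g).
_⊘_ : ℤ⟦q⟧ → ℤ⟦q⟧ → ℤ⟦q⟧
(f ⊘ g) zero    = f 0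
(f ⊘ g) (suc n) = ((λ k → f (suc k) ℤ.- f 0 ℤ.* g (suc k)) ⊘ g) n

⊘-⊗ : ∀ f g → g 0 ≡ 1ℤ → (f ⊘ g) ⊗ g ≗ f
⊘-⊗ f g g₀≡1 zero = begin
  f 0 ℤ.* g 0 ℤ.+ 0ℤ ≡⟨ ℤₚ.+-identityʳ _ ⟩
  f 0 ℤ.* g 0        ≡⟨ cong (f 0 ℤ.*_) g₀≡1 ⟩
  f 0 ℤ.* 1ℤ         ≡⟨ ℤₚ.*-identityʳ _ ⟩
  f 0                ∎
  where open ≡-Reasoning
⊘-⊗ f g g₀≡1 (suc n) = begin
  c ℤ.+ (h ⊘ g ⊗ g) n          ≡⟨ cong (λ y → c ℤ.+ y) (⊘-⊗ h g g₀≡1 n) ⟩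
  c ℤ.+ (f (suc n) ℤ.- c)      ≡⟨ ℤₚ.+-comm c _ ⟩
  f (suc n) ℤ.- c ℤ.+ c        ≡⟨ ℤₚ.+-assoc (f (suc n)) (ℤ.- c) c ⟩
  f (suc n) ℤ.+ (ℤ.- c ℤ.+ c)  ≡⟨ cong (λ y → f (suc n) ℤ.+ y) (ℤₚ.+-inverseˡ c) ⟩
  f (suc n) ℤ.+ 0ℤ             ≡⟨ ℤₚ.+-identityʳ _ ⟩
  f (suc n)                    ∎
  where
  open ≡-Reasoning
  c = f 0 ℤ.* g (suc n)
  h : ℤ⟦q⟧
  h k = f (suc k) ℤ.- f 0 ℤ.* g (suc k)

-- ⟨ a ⨾ b ⟩ n is the q-Pochhammer symbol (a; b)ₙ.
⟨_⨾_⟩_ : ℤ⟦q⟧ → ℤ⟦q⟧ → ℕ → ℤ⟦q⟧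
⟨ a ⨾ b ⟩ zero  = q^ 0
⟨ a ⨾ b ⟩ suc n = ⟨ a ⨾ b ⟩ n ⊗ (q^ 0 ⊖ a ⊗ b ^ n)

-- Power series in x over ℤ⟦q⟧: F m n is the coefficient of xᵐ qⁿ.
ℤ⟦x,q⟧ : Set
ℤ⟦x,q⟧ = ℕ → ℤ⟦q⟧

x^_·_ : ℕ → ℤ⟦q⟧ → ℤ⟦x,q⟧
(x^ a · f) m = if does (m ≟ a) then f else λ _ → 0ℤ

_⊕_ : ℤ⟦x,q⟧ → ℤ⟦x,q⟧ → ℤ⟦x,q⟧
(F ⊕ G) m n = F m n ℤ.+ G m n

_≈_ : ℤ⟦x,q⟧ → ℤ⟦x,q⟧ → Set
F ≈ G = ∀ m n → F m n ≡ G m n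

infixl 6 _⊕_
infix  4 _≈_

-- The family F is summable with sum S, in the sense of formal power series:
-- for every monomial, only finitely many members of the family have a nonzero
-- coefficient there, and these coefficients add up to that of S.
HasSum : {I : Set} → (I → ℤ⟦x,q⟧) → ℤ⟦x,q⟧ → Set
HasSum {I} F S = ∀ m n →
  Σ[ L ∈ List I ] Unique L
    × (∀ i → i ∉ L → F i m n ≡ 0ℤ)
    × foldr ℤ._+_ 0ℤ (List.map (λ i → F i m n) L) ≡ S m n

{-# OPTIONS --safe #-}

-- Put S(a,b) = Σ x^(i+2j) q^(2i²+6ij+6j²+ai+bj) / ((q;q)ᵢ (q³;q³)ⱼ).  Cancelling the factor 1 - qⁱ or
-- 1 - q³ʲ of a denominator expresses S(a,b) - S(a+1,b) and S(a,b) - S(a,b+3) as monomial multiples of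
-- another S.  The set 𝒞 is invariant under adding 3 to every part, which is the substitution x ↦ x q³,
-- sending S(a,b) to S(a+3,b+6).  Sorting partitions by their smallest part gives recurrences for the
-- generating functions of the partitions with parts at least 3t+1, 3t+2, 3t+3, and the contiguity
-- relations show that G t = S(3t,6t) and H t = S(3t+1,6t+3) solve the last two.  Both
-- W = H 0 + x q (G 1), which counts 𝒫₂, and the fourfold sum satisfy
--   W(x) = (1 + x q³) W(x q³) + (x q + x q⁵ + x² q⁶) W(x q⁶) + (x² q⁹ - x³ q¹⁵) W(x q⁹),
-- and this equation determines a series from its constant term in x.

module Submission where

open import Defs
open import Data.Bool.Base using (if_then_else_)
open import Data.Empty using (⊥; ⊥-elim; ⊥-elim-irr)
open import Data.Integer.Base as ℤ using (ℤ; 0ℤ; 1ℤ)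
open import Data.Integer.Properties as ℤₚ using ()
open import Data.Integer.Tactic.RingSolver as ℤ-Solver using ()
open import Data.Irrelevant using ([_])
open import Data.List.Base as List using (List; []; _∷_; _++_; length)
import Data.List.Membership.DecPropositional as DecMembership
open import Data.List.Membership.Propositional using (_∈_; _∉_)
open import Data.List.Membership.Propositional.Properties using (∈-map⁺; ∈-map⁻; ∈-++⁺ˡ; ∈-++⁺ʳ; ∈-++⁻)
open import Data.List.Properties as Listₚ using ()
open import Data.List.Relation.Unary.All as All using (All; []; _∷_)
open import Data.List.Relation.Unary.AllPairs using ([]; _∷_)
open import Data.List.Relation.Unary.Any using (here; there)
open import Data.List.Relation.Unary.Linked as Linked using (Linked; []; [-]; _∷_)
open import Data.List.Relation.Unary.Unique.Propositional using (Unique)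
import Data.List.Relation.Unary.Unique.Propositional.Properties as Uniqueₚ
open import Data.Nat using (ℕ; zero; suc; _+_; _*_; _∸_; _/_; _≤_; _<_; s≤s; z≤n)
open import Data.Nat.Divisibility using (_∣_; _∣?_; ∣m+n∣m⇒∣n; ∣m∣n⇒∣m+n; n∣m*n)
open import Data.Nat.DivMod using (m*n/n≡m)
open import Data.Nat.Induction using (<-rec)
open import Data.Nat.ListAction using (sum)
open import Data.Nat.Properties as ℕₚ using (_≟_)
open import Data.Nat.Tactic.RingSolver as ℕ-Solver using ()
open import Data.Product using (Σ-syntax; ∃-syntax; _×_; _,_; proj₁; proj₂; map₁; map₂)
open import Data.Refinement using (Refinement-syntax; value; _,_)
open import Data.Sum.Base using (_⊎_; inj₁; inj₂; [_,_]′)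
open import Data.Unit.Base using (⊤; tt)
open import Function.Base using (_∘_)
open import Relation.Binary.PropositionalEquality
open import Relation.Nullary using (¬_; Dec; yes; no)
open import Relation.Nullary.Decidable using (dec-true; dec-false; from-yes; from-no)
open import Relation.Unary using () renaming (_≐_ to _⇔_)
open import Algebra.Properties.AbelianGroup ℤₚ.+-0-abelianGroup using () renaming (∙-cancelʳ to +-cancelʳ)


-- Formal power series in q

-- The residue of a part modulo 3 decides what may follow it: a gap of 2 after a needs 3 to divide
-- 2a + 2, hence a ≡ 2, and a gap of 3 needs 3 to divide a. So the three families of lower bounds
-- close up under removal of the smallest part, and the family with bound 3t + 1 is expressed
-- through `G`. The obstacle is that these recurrences are not well founded as they stand:
-- forbidding one more smallest part leads from bound 3t + 3 to bound 3(t + 1) + 3 with the same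
-- number of parts. They are run at a fixed coefficient of xᵐ qⁿ, where a large t leaves at most the
-- empty list, while every term with a factor x concerns fewer parts. The negative term of the
-- functional equation is kept on the other side, so that every relation between series is an
-- equality of sums of monomial multiples and can be combined with others as integer linear algebra,
-- coefficient by coefficient.

tail : ℤ⟦q⟧ → ℤ⟦q⟧
tail f n = f (suc n)

⊗-cong : ∀ {f f′ g g′} → f ≗ f′ → g ≗ g′ → f ⊗ g ≗ f′ ⊗ g′
⊗-cong p r zero    = cong₂ (λ x y → x ℤ.* y ℤ.+ 0ℤ) (p 0) (r 0)
⊗-cong p r (suc n) = cong₂ ℤ._+_ (cong₂ ℤ._*_ (p 0) (r (suc n))) (⊗-cong (p ∘ suc) r n)

⊗-congˡ : ∀ f {g g′} → g ≗ g′ → f ⊗ g ≗ f ⊗ g′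
⊗-congˡ f = ⊗-cong {f} (λ _ → refl)

⊗-congʳ : ∀ {f f′} g → f ≗ f′ → f ⊗ g ≗ f′ ⊗ g
⊗-congʳ g p = ⊗-cong {g = g} p (λ _ → refl)

-- The left factor has the shape of a tail of a product: `tail (f ⊗ g)` unfolds to `f 0` times
-- `tail g` plus `tail f ⊗ g`. This is what the induction for associativity meets.
⊗-linearˡ : ∀ c f g h n → ((λ k → c ℤ.* f k ℤ.+ g k) ⊗ h) n ≡ c ℤ.* (f ⊗ h) n ℤ.+ (g ⊗ h) n
⊗-linearˡ c f g h zero    = lemma c (f 0) (g 0) (h 0)
  where
  lemma : ∀ c x y z → (c ℤ.* x ℤ.+ y) ℤ.* z ℤ.+ 0ℤ ≡ c ℤ.* (x ℤ.* z ℤ.+ 0ℤ) ℤ.+ (y ℤ.* z ℤ.+ 0ℤ)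
  lemma = ℤ-Solver.solve-∀
⊗-linearˡ c f g h (suc n) = trans
  (cong (ℤ._+_ ((c ℤ.* f 0 ℤ.+ g 0) ℤ.* h (suc n))) (⊗-linearˡ c (tail f) (tail g) h n))
  (lemma c (f 0) (g 0) (h (suc n)) ((tail f ⊗ h) n) ((tail g ⊗ h) n))
  where
  lemma : ∀ c x y z u v → (c ℤ.* x ℤ.+ y) ℤ.* z ℤ.+ (c ℤ.* u ℤ.+ v)
                        ≡ c ℤ.* (x ℤ.* z ℤ.+ u) ℤ.+ (y ℤ.* z ℤ.+ v)
  lemma = ℤ-Solver.solve-∀

⊗-tailʳ : ∀ f g n → (f ⊗ g) (suc n) ≡ f (suc n) ℤ.* g 0 ℤ.+ (f ⊗ tail g) n
⊗-tailʳ f g zero    = lemma (f 0) (f 1) (g 0) (g 1)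
  where
  lemma : ∀ x y z w → x ℤ.* w ℤ.+ (y ℤ.* z ℤ.+ 0ℤ) ≡ y ℤ.* z ℤ.+ (x ℤ.* w ℤ.+ 0ℤ)
  lemma = ℤ-Solver.solve-∀
⊗-tailʳ f g (suc n) = trans
  (cong (ℤ._+_ (f 0 ℤ.* g (suc (suc n)))) (⊗-tailʳ (tail f) g n))
  (lemma (f 0 ℤ.* g (suc (suc n))) (f (suc (suc n)) ℤ.* g 0) ((tail f ⊗ tail g) n))
  where
  lemma : ∀ x y z → x ℤ.+ (y ℤ.+ z) ≡ y ℤ.+ (x ℤ.+ z)
  lemma = ℤ-Solver.solve-∀

⊗-comm : ∀ f g → f ⊗ g ≗ g ⊗ f
⊗-comm f g zero    = cong (ℤ._+ 0ℤ) (ℤₚ.*-comm (f 0) (g 0))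
⊗-comm f g (suc n) = trans
  (cong₂ ℤ._+_ (ℤₚ.*-comm (f 0) (g (suc n))) (⊗-comm (tail f) g n))
  (sym (⊗-tailʳ g f n))

⊗-assoc : ∀ f g h → (f ⊗ g) ⊗ h ≗ f ⊗ (g ⊗ h)
⊗-assoc f g h zero    = lemma (f 0) (g 0) (h 0)
  where
  lemma : ∀ x y z → (x ℤ.* y ℤ.+ 0ℤ) ℤ.* z ℤ.+ 0ℤ ≡ x ℤ.* (y ℤ.* z ℤ.+ 0ℤ) ℤ.+ 0ℤ
  lemma = ℤ-Solver.solve-∀
⊗-assoc f g h (suc n) = trans
  (cong (ℤ._+_ ((f 0 ℤ.* g 0 ℤ.+ 0ℤ) ℤ.* h (suc n)))
    (trans (⊗-linearˡ (f 0) (tail g) (tail f ⊗ g) h n)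
           (cong (ℤ._+_ (f 0 ℤ.* (tail g ⊗ h) n)) (⊗-assoc (tail f) g h n))))
  (lemma (f 0) (g 0) (h (suc n)) ((tail g ⊗ h) n) ((tail f ⊗ (g ⊗ h)) n))
  where
  lemma : ∀ x y z u v → (x ℤ.* y ℤ.+ 0ℤ) ℤ.* z ℤ.+ (x ℤ.* u ℤ.+ v)
                      ≡ x ℤ.* (y ℤ.* z ℤ.+ u) ℤ.+ v
  lemma = ℤ-Solver.solve-∀

⊘-congˡ : ∀ {f f′} g → f ≗ f′ → f ⊘ g ≗ f′ ⊘ g
⊘-congˡ g p zero    = p 0
⊘-congˡ g p (suc n) = ⊘-congˡ g (λ k → cong₂ (λ x y → x ℤ.- y ℤ.* g (suc k)) (p (suc k)) (p 0)) n

⊗-⊘ : ∀ f g → g 0 ≡ 1ℤ → (f ⊗ g) ⊘ g ≗ f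
⊗-⊘ f g g₀≡1 zero    = trans (cong (λ y → f 0 ℤ.* y ℤ.+ 0ℤ) g₀≡1) (lemma (f 0))
  where
  lemma : ∀ x → x ℤ.* 1ℤ ℤ.+ 0ℤ ≡ x
  lemma = ℤ-Solver.solve-∀
⊗-⊘ f g g₀≡1 (suc n) = trans (⊘-congˡ g remainder n) (⊗-⊘ (tail f) g g₀≡1 n)
  where
  lemma : ∀ x y z → x ℤ.* z ℤ.+ y ℤ.- (x ℤ.* 1ℤ ℤ.+ 0ℤ) ℤ.* z ≡ y
  lemma = ℤ-Solver.solve-∀
  remainder : ∀ k → (f ⊗ g) (suc k) ℤ.- (f ⊗ g) 0 ℤ.* g (suc k) ≡ (tail f ⊗ g) k
  remainder k = trans
    (cong (λ y → (f ⊗ g) (suc k) ℤ.- (f 0 ℤ.* y ℤ.+ 0ℤ) ℤ.* g (suc k)) g₀≡1)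
    (lemma (f 0) ((tail f ⊗ g) k) (g (suc k)))

⊘-unique : ∀ f g h → g 0 ≡ 1ℤ → f ⊗ g ≗ h → f ≗ h ⊘ g
⊘-unique f g h g₀≡1 p n = trans (sym (⊗-⊘ f g g₀≡1 n)) (⊘-congˡ g p n)

-- Multiplication by the a-th power of a variable. It is generic in the coefficients because it
-- serves for q, with default `0ℤ`, and for x, with the zero series as default.
shift : {A : Set} → A → ℕ → (ℕ → A) → ℕ → A
shift z zero    f n       = f n
shift z (suc a) f zero    = z
shift z (suc a) f (suc n) = shift z a f n

shift-+ : ∀ {A : Set} (z : A) a b f → shift z a (shift z b f) ≗ shift z (a + b) f
shift-+ z zero    b f n       = refl
shift-+ z (suc a) b f zero    = refl
shift-+ z (suc a) b f (suc n) = shift-+ z a b f n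

shift-< : ∀ {A : Set} (z : A) {a n} f → n < a → shift z a f n ≡ z
shift-< z {suc a} {zero}  f _         = refl
shift-< z {suc a} {suc n} f (s≤s n<a) = shift-< z f n<a

infixr 8 _↑_

_↑_ : ℕ → ℤ⟦q⟧ → ℤ⟦q⟧
_↑_ = shift 0ℤ

-- The bound `k + e ≤ n` serves strong induction on n: for positive `e` only coefficients strictly
-- below n enter.
↑-local : ∀ e {f g} n → (∀ k → k + e ≤ n → f k ≡ g k) → (e ↑ f) n ≡ (e ↑ g) n
↑-local zero    n       p = p n (ℕₚ.≤-reflexive (ℕₚ.+-identityʳ n))
↑-local (suc e) zero    p = refl
↑-local (suc e) (suc n) p =
  ↑-local e n (λ k le → p k (subst (_≤ suc n) (sym (ℕₚ.+-suc k e)) (s≤s le)))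

↑-cong : ∀ e {f g} → f ≗ g → e ↑ f ≗ e ↑ g
↑-cong e p n = ↑-local e n (λ k _ → p k)

↑-linear : ∀ e f g n → (e ↑ λ k → f k ℤ.+ g k) n ≡ (e ↑ f) n ℤ.+ (e ↑ g) n
↑-linear zero    f g n       = refl
↑-linear (suc e) f g zero    = refl
↑-linear (suc e) f g (suc n) = ↑-linear e f g n

↑-0 : ∀ e n → (e ↑ λ _ → 0ℤ) n ≡ 0ℤ
↑-0 zero    n       = refl
↑-0 (suc e) zero    = refl
↑-0 (suc e) (suc n) = ↑-0 e n

0⊗ : ∀ g n → ((λ _ → 0ℤ) ⊗ g) n ≡ 0ℤ
0⊗ g zero    = refl
0⊗ g (suc n) = trans (ℤₚ.+-identityˡ _) (0⊗ g n)

q^⊗ : ∀ a f → q^ a ⊗ f ≗ a ↑ f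
q^⊗ zero    f zero    = lemma (f 0)
  where
  lemma : ∀ x → 1ℤ ℤ.* x ℤ.+ 0ℤ ≡ x
  lemma = ℤ-Solver.solve-∀
q^⊗ zero    f (suc n) = trans (cong (ℤ._+_ (1ℤ ℤ.* f (suc n))) (0⊗ f n)) (lemma (f (suc n)))
  where
  lemma : ∀ x → 1ℤ ℤ.* x ℤ.+ 0ℤ ≡ x
  lemma = ℤ-Solver.solve-∀
q^⊗ (suc a) f zero    = refl
q^⊗ (suc a) f (suc n) = trans (ℤₚ.+-identityˡ _) (q^⊗ a f n)

⊗-identityʳ : ∀ f → f ⊗ q^ 0 ≗ f
⊗-identityʳ f n = trans (⊗-comm f (q^ 0) n) (q^⊗ 0 f n)

↑-q^ : ∀ a b → a ↑ q^ b ≗ q^ (a + b)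
↑-q^ zero    b n       = refl
↑-q^ (suc a) b zero    = refl
↑-q^ (suc a) b (suc n) = ↑-q^ a b n

q^-^ : ∀ b n → (q^ b) ^ n ≗ q^ (n * b)
q^-^ b zero    k = refl
q^-^ b (suc n) k = trans (q^⊗ b ((q^ b) ^ n) k)
  (trans (↑-cong b (q^-^ b n) k) (↑-q^ b (n * b) k))

⊗-1-q^ : ∀ f c n → (f ⊗ (q^ 0 ⊖ q^ c)) n ≡ f n ℤ.- (c ↑ f) n
⊗-1-q^ f c n = begin
  (f ⊗ (q^ 0 ⊖ q^ c)) n                       ≡⟨ ⊗-comm f (q^ 0 ⊖ q^ c) n ⟩
  ((q^ 0 ⊖ q^ c) ⊗ f) n                       ≡⟨ ⊗-congʳ f (λ k → lemma₁ ((q^ 0) k) ((q^ c) k)) n ⟩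
  ((λ k → ℤ.-1ℤ ℤ.* (q^ c) k ℤ.+ (q^ 0) k) ⊗ f) n ≡⟨ ⊗-linearˡ ℤ.-1ℤ (q^ c) (q^ 0) f n ⟩
  ℤ.-1ℤ ℤ.* (q^ c ⊗ f) n ℤ.+ (q^ 0 ⊗ f) n     ≡⟨ cong₂ (λ x y → ℤ.-1ℤ ℤ.* x ℤ.+ y) (q^⊗ c f n) (q^⊗ 0 f n) ⟩
  ℤ.-1ℤ ℤ.* (c ↑ f) n ℤ.+ f n                 ≡⟨ lemma₁ (f n) ((c ↑ f) n) ⟨
  f n ℤ.- (c ↑ f) n                           ∎
  where
  open ≡-Reasoning
  lemma₁ : ∀ x y → x ℤ.- y ≡ ℤ.-1ℤ ℤ.* y ℤ.+ x
  lemma₁ = ℤ-Solver.solve-∀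

q^⊘ : ∀ e g → g 0 ≡ 1ℤ → q^ e ⊘ g ≗ e ↑ (q^ 0 ⊘ g)
q^⊘ e g g₀≡1 n = sym (⊘-unique (e ↑ (q^ 0 ⊘ g)) g (q^ e) g₀≡1 (λ k → begin
  ((e ↑ (q^ 0 ⊘ g)) ⊗ g) k      ≡⟨ ⊗-congʳ g (λ i → sym (q^⊗ e (q^ 0 ⊘ g) i)) k ⟩
  ((q^ e ⊗ (q^ 0 ⊘ g)) ⊗ g) k   ≡⟨ ⊗-assoc (q^ e) (q^ 0 ⊘ g) g k ⟩
  (q^ e ⊗ (q^ 0 ⊘ g ⊗ g)) k     ≡⟨ ⊗-congˡ (q^ e) (⊘-⊗ (q^ 0) g g₀≡1) k ⟩
  (q^ e ⊗ q^ 0) k               ≡⟨ ⊗-identityʳ (q^ e) k ⟩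
  (q^ e) k                      ∎) n)
  where open ≡-Reasoning

-- With E = 1/g′ one has E (1 - q^c) g = E g′ = 1, so E - q^c E = 1/g. All contiguity relations rest
-- on this cancellation.
⊘-extend : ∀ g g′ c → g 0 ≡ 1ℤ → g′ 0 ≡ 1ℤ → g′ ≗ g ⊗ (q^ 0 ⊖ q^ c) →
           ∀ n → (q^ 0 ⊘ g′) n ≡ (c ↑ (q^ 0 ⊘ g′)) n ℤ.+ (q^ 0 ⊘ g) n
⊘-extend g g′ c g₀≡1 g′₀≡1 p n = begin
  E n                                   ≡⟨ lemma (E n) ((c ↑ E) n) ⟩
  (c ↑ E) n ℤ.+ (E n ℤ.- (c ↑ E) n)     ≡⟨ cong (ℤ._+_ ((c ↑ E) n)) (⊗-1-q^ E c n) ⟨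
  (c ↑ E) n ℤ.+ (E ⊗ u) n               ≡⟨ cong (ℤ._+_ ((c ↑ E) n)) (⊘-unique (E ⊗ u) g (q^ 0) g₀≡1 E⊗u⊗g n) ⟩
  (c ↑ E) n ℤ.+ (q^ 0 ⊘ g) n            ∎
  where
  open ≡-Reasoning
  E = q^ 0 ⊘ g′
  u = q^ 0 ⊖ q^ c
  lemma : ∀ x y → x ≡ y ℤ.+ (x ℤ.- y)
  lemma = ℤ-Solver.solve-∀
  E⊗u⊗g : (E ⊗ u) ⊗ g ≗ q^ 0
  E⊗u⊗g k = begin
    ((E ⊗ u) ⊗ g) k ≡⟨ ⊗-assoc E u g k ⟩
    (E ⊗ (u ⊗ g)) k ≡⟨ ⊗-congˡ E (λ i → trans (⊗-comm u g i) (sym (p i))) k ⟩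
    (E ⊗ g′) k      ≡⟨ ⊘-⊗ (q^ 0) g′ g′₀≡1 k ⟩
    (q^ 0) k        ∎

⟨_⟩_ : ℕ → ℕ → ℤ⟦q⟧
⟨ b ⟩ n = ⟨ q^ b ⨾ q^ b ⟩ n

⟨⟩-suc : ∀ b n → ⟨ b ⟩ suc n ≗ ⟨ b ⟩ n ⊗ (q^ 0 ⊖ q^ (suc n * b))
⟨⟩-suc b n = ⊗-congˡ (⟨ b ⟩ n) λ k → cong (λ x → (q^ 0) k ℤ.- x)
  (trans (q^⊗ b ((q^ b) ^ n) k) (trans (↑-cong b (q^-^ b n) k) (↑-q^ b (n * b) k)))

⊗-unit : ∀ f g → f 0 ≡ 1ℤ → g 0 ≡ 1ℤ → (f ⊗ g) 0 ≡ 1ℤ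
⊗-unit f g p r = cong₂ (λ x y → x ℤ.* y ℤ.+ 0ℤ) p r

⟨⟩-unit : ∀ b n → (⟨ suc b ⟩ n) 0 ≡ 1ℤ
⟨⟩-unit b zero    = refl
⟨⟩-unit b (suc n) = ⊗-unit (⟨ suc b ⟩ n) (q^ 0 ⊖ q^ suc b ⊗ (q^ suc b) ^ n) (⟨⟩-unit b n) refl

⊗-swapʳ : ∀ f g h → (f ⊗ g) ⊗ h ≗ (f ⊗ h) ⊗ g
⊗-swapʳ f g h n = trans (⊗-assoc f g h n)
  (trans (⊗-congˡ f (⊗-comm g h) n) (sym (⊗-assoc f h g n)))

⊗-growʳ : ∀ f g {g′} u → g′ ≗ g ⊗ u → f ⊗ g′ ≗ (f ⊗ g) ⊗ u
⊗-growʳ f g u p n = trans (⊗-congˡ f p n) (sym (⊗-assoc f g u n))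

⊗-growˡ : ∀ f g {f′} u → f′ ≗ f ⊗ u → f′ ⊗ g ≗ (f ⊗ g) ⊗ u
⊗-growˡ f g u p n = trans (⊗-congʳ g p n) (⊗-swapʳ f u g n)

-- Monomial multiples of series in x and q, and linear relations between them

x^-≡ : ∀ m a f n → m ≡ a → (x^ a · f) m n ≡ f n
x^-≡ m a f n p = cong (λ b → (if b then f else λ _ → 0ℤ) n) (dec-true (m ≟ a) p)

x^-≢ : ∀ m a f n → m ≢ a → (x^ a · f) m n ≡ 0ℤ
x^-≢ m a f n p = cong (λ b → (if b then f else λ _ → 0ℤ) n) (dec-false (m ≟ a) p)

mono : ℕ → ℕ → ℤ⟦x,q⟧ → ℤ⟦x,q⟧
mono α β F m = β ↑ shift (λ _ → 0ℤ) α F m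

mono-local : ∀ α β {F G} m n → (∀ k → k + α ≤ m → F k ≗ G k) → mono α β F m n ≡ mono α β G m n
mono-local zero    β m       n p = ↑-cong β (p m (ℕₚ.≤-reflexive (ℕₚ.+-identityʳ m))) n
mono-local (suc α) β zero    n p = refl
mono-local (suc α) β (suc m) n p =
  mono-local α β m n (λ k le → p k (subst (_≤ suc m) (sym (ℕₚ.+-suc k α)) (s≤s le)))

mono-cong : ∀ α β {F G} → F ≈ G → mono α β F ≈ mono α β G
mono-cong α β p m n = mono-local α β m n (λ k _ → p k)

mono-⊕ : ∀ α β F G → mono α β (F ⊕ G) ≈ mono α β F ⊕ mono α β G
mono-⊕ zero    β F G m       n = ↑-linear β (F m) (G m) n
mono-⊕ (suc α) β F G zero    n = trans (↑-0 β n) (sym (cong₂ ℤ._+_ (↑-0 β n) (↑-0 β n)))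
mono-⊕ (suc α) β F G (suc m) n = mono-⊕ α β F G m n

mono-mono : ∀ α β γ δ F → mono α β (mono γ δ F) ≈ mono (α + γ) (β + δ) F
mono-mono zero    β γ δ F m       n = shift-+ 0ℤ β δ (shift (λ _ → 0ℤ) γ F m) n
mono-mono (suc α) β γ δ F zero    n = trans (↑-0 β n) (sym (↑-0 (β + δ) n))
mono-mono (suc α) β γ δ F (suc m) n = mono-mono α β γ δ F m n

infix 9 _⟪_,_⟫
infix 4 _≐_

-- The monomial is kept as data, so multiplying a relation by another monomial adds exponents
-- instead of nesting `mono`, and equal terms can be recognised by unification.
record Term : Set where
  constructor _⟪_,_⟫
  field
    body      : ℤ⟦x,q⟧
    xexp qexp : ℕ

⟦_⟧ : Term → ℤ⟦x,q⟧
⟦ F ⟪ α , β ⟫ ⟧ = mono α β F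

⟦_⟧* : List Term → ℤ⟦x,q⟧
⟦ []     ⟧* _ _ = 0ℤ
⟦ T ∷ Ts ⟧*     = ⟦ T ⟧ ⊕ ⟦ Ts ⟧*

-- A record between syntactic terms, so that Agda can infer both sides.
record _≐_ (T : Term) (Ts : List Term) : Set where
  constructor pointwise
  field at : ⟦ T ⟧ ≈ ⟦ Ts ⟧*

open _≐_

scale : ℕ → ℕ → Term → Term
scale α β (F ⟪ γ , δ ⟫) = F ⟪ γ + α , δ + β ⟫

mono-scale : ∀ α β T → mono α β ⟦ T ⟧ ≈ ⟦ scale α β T ⟧
mono-scale α β (F ⟪ γ , δ ⟫) m n = trans (mono-mono α β γ δ F m n)
  (cong₂ (λ k l → mono k l F m n) (ℕₚ.+-comm α γ) (ℕₚ.+-comm β δ))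

mono-⟦⟧* : ∀ α β Ts → mono α β ⟦ Ts ⟧* ≈ ⟦ List.map (scale α β) Ts ⟧*
mono-⟦⟧* zero    β [] m       n = ↑-0 β n
mono-⟦⟧* (suc α) β [] zero    n = ↑-0 β n
mono-⟦⟧* (suc α) β [] (suc m) n = mono-⟦⟧* α β [] m n
mono-⟦⟧* α β (T ∷ Ts) m n = trans (mono-⊕ α β ⟦ T ⟧ ⟦ Ts ⟧* m n)
  (cong₂ ℤ._+_ (mono-scale α β T m n) (mono-⟦⟧* α β Ts m n))

scaled : ∀ α β {T Ts} → T ≐ Ts → scale α β T ≐ List.map (scale α β) Ts
scaled α β {T} {Ts} p .at m n = trans (sym (mono-scale α β T m n))
  (trans (mono-cong α β (at p) m n) (mono-⟦⟧* α β Ts m n))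

-- Sums over solutions of weight equations

total : {I : Set} → List I → (I → ℤ) → ℤ
total L f = List.foldr ℤ._+_ 0ℤ (List.map f L)

module _ {I : Set} where

  total-cong : ∀ (L : List I) {f g} → (∀ {i} → i ∈ L → f i ≡ g i) → total L f ≡ total L g
  total-cong []      p = refl
  total-cong (i ∷ L) p = cong₂ ℤ._+_ (p (here refl)) (total-cong L (p ∘ there))

  total-0 : ∀ (L : List I) {f} → (∀ i → f i ≡ 0ℤ) → total L f ≡ 0ℤ
  total-0 []      p = refl
  total-0 (i ∷ L) p = cong₂ ℤ._+_ (p i) (total-0 L p)

  total-+ : ∀ (L : List I) f g → total L (λ i → f i ℤ.+ g i) ≡ total L f ℤ.+ total L g
  total-+ []      f g = refl
  total-+ (i ∷ L) f g = trans (cong (ℤ._+_ (f i ℤ.+ g i)) (total-+ L f g))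
                              (lemma (f i) (g i) (total L f) (total L g))
    where
    lemma : ∀ x y u v → x ℤ.+ y ℤ.+ (u ℤ.+ v) ≡ x ℤ.+ u ℤ.+ (y ℤ.+ v)
    lemma = ℤ-Solver.solve-∀

  total-++ : ∀ (L M : List I) f → total (L ++ M) f ≡ total L f ℤ.+ total M f
  total-++ []      M f = sym (ℤₚ.+-identityˡ _)
  total-++ (i ∷ L) M f = trans (cong (ℤ._+_ (f i)) (total-++ L M f)) (sym (ℤₚ.+-assoc (f i) _ _))

  total-map : ∀ {J : Set} (h : J → I) L f → total (List.map h L) f ≡ total L (f ∘ h)
  total-map h L f = cong (List.foldr ℤ._+_ 0ℤ) (sym (Listₚ.map-∘ L))

  total-↑ : ∀ e (L : List I) (f : I → ℤ⟦q⟧) n →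
            (e ↑ λ k → total L (λ i → f i k)) n ≡ total L (λ i → (e ↑ f i) n)
  total-↑ e []      f n = ↑-0 e n
  total-↑ e (i ∷ L) f n = trans (↑-linear e (f i) (λ k → total L (λ i → f i k)) n)
                                (cong (ℤ._+_ ((e ↑ f i) n)) (total-↑ e L f n))

record Weighting {I : Set} (wt : I → ℕ) : Set where
  field
    solutions : ℕ → List I
    unique    : ∀ m → Unique (solutions m)
    sound     : ∀ {m i} → i ∈ solutions m → wt i ≡ m
    complete  : ∀ i → i ∈ solutions (wt i)

  series : (I → ℤ⟦q⟧) → ℤ⟦x,q⟧
  series τ m n = total (solutions m) (λ i → τ i n)

  hasSum : ∀ τ → HasSum (λ i → x^ wt i · τ i) (series τ)
  hasSum τ m n = solutions m , unique m , outside , total-cong (solutions m) inside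
    where
    outside : ∀ i → i ∉ solutions m → (x^ wt i · τ i) m n ≡ 0ℤ
    outside i i∉ = x^-≢ m (wt i) (τ i) n λ { refl → i∉ (complete i) }
    inside : ∀ {i} → i ∈ solutions m → (x^ wt i · τ i) m n ≡ τ i n
    inside {i} i∈ = x^-≡ m (wt i) (τ i) n (sym (sound i∈))

open Weighting

-- Holds when s is injective, raises the weight by d, and misses only indices in Z.
record Peel {I : Set} {wt : I → ℕ} (W : Weighting wt) (s : I → I) (d : ℕ) (Z : I → Set) : Set where
  constructor peeling
  field
    peel : ∀ f → (∀ i → Z i → f i ≡ 0ℤ) →
           ∀ m → total (solutions W m) f ≡ shift 0ℤ d (λ k → total (solutions W k) (f ∘ s)) m

open Peel

doubles : Weighting (2 *_)
doubles = record { solutions = sols ; unique = uniq ; sound = λ {m} → snd m ; complete = cmp }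
  where
  sols : ℕ → List ℕ
  sols 0             = 0 ∷ []
  sols 1             = []
  sols (suc (suc m)) = List.map suc (sols m)
  2*suc : ∀ i → 2 * suc i ≡ suc (suc (2 * i))
  2*suc i = cong suc (ℕₚ.+-suc i (i + 0))
  uniq : ∀ m → Unique (sols m)
  uniq 0             = [] ∷ []
  uniq 1             = []
  uniq (suc (suc m)) = Uniqueₚ.map⁺ ℕₚ.suc-injective (uniq m)
  snd : ∀ m {i} → i ∈ sols m → 2 * i ≡ m
  snd 0             (here refl) = refl
  snd (suc (suc m)) i∈ with ∈-map⁻ suc i∈
  ... | i , i∈′ , refl = trans (2*suc i) (cong (suc ∘ suc) (snd m i∈′))
  cmp : ∀ i → i ∈ sols (2 * i)
  cmp zero    = here refl
  cmp (suc i) = subst (λ m → suc i ∈ sols m) (sym (2*suc i)) (∈-map⁺ suc (cmp i))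

doubles-peel : Peel doubles suc 2 (_≡ 0)
doubles-peel = peeling λ
  { f p 0             → cong (ℤ._+ 0ℤ) (p 0 refl)
  ; f p 1             → refl
  ; f p (suc (suc m)) → total-map suc (solutions doubles m) f }

module _ {I : Set} {wt : I → ℕ} (W : Weighting wt) where

  private
    sols : ℕ → List (ℕ × I)
    sols zero    = List.map (0 ,_) (solutions W 0)
    sols (suc m) = List.map (0 ,_) (solutions W (suc m)) ++ List.map (map₁ suc) (sols m)

    0,-unique : ∀ m → Unique (List.map (0 ,_) (solutions W m))
    0,-unique m = Uniqueₚ.map⁺ (cong proj₂) (unique W m)

    uniq : ∀ m → Unique (sols m)
    uniq zero    = 0,-unique 0
    uniq (suc m) = Uniqueₚ.++⁺ (0,-unique (suc m)) (Uniqueₚ.map⁺ inj (uniq m)) disjoint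
      where
      inj : ∀ {p r : ℕ × I} → map₁ suc p ≡ map₁ suc r → p ≡ r
      inj refl = refl
      disjoint : ∀ {p} → p ∈ List.map (0 ,_) (solutions W (suc m)) × p ∈ List.map (map₁ suc) (sols m) → ⊥
      disjoint (l , r) with ∈-map⁻ (0 ,_) l | ∈-map⁻ (map₁ suc) r
      ... | _ , _ , refl | _ , _ , ()

    snd : ∀ m {p} → p ∈ sols m → proj₁ p + wt (proj₂ p) ≡ m
    snd zero    p∈ with ∈-map⁻ (0 ,_) p∈
    ... | _ , i∈ , refl = sound W i∈
    snd (suc m) p∈ with ∈-++⁻ (List.map (0 ,_) (solutions W (suc m))) p∈
    ... | inj₁ l with ∈-map⁻ (0 ,_) l
    ...   | _ , i∈ , refl = sound W i∈
    snd (suc m) p∈ | inj₂ r with ∈-map⁻ (map₁ suc) r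
    ...   | _ , p∈′ , refl = cong suc (snd m p∈′)

    cmp : ∀ p → p ∈ sols (proj₁ p + wt (proj₂ p))
    cmp (zero , i) with wt i | complete W i
    ... | zero  | i∈ = ∈-map⁺ (0 ,_) i∈
    ... | suc m | i∈ = ∈-++⁺ˡ (∈-map⁺ (0 ,_) i∈)
    cmp (suc k , i) = ∈-++⁺ʳ (List.map (0 ,_) (solutions W (suc (k + wt i)))) (∈-map⁺ (map₁ suc) (cmp (k , i)))

  ℕ× : Weighting (λ p → proj₁ p + wt (proj₂ p))
  ℕ× = record { solutions = sols ; unique = uniq ; sound = λ {m} → snd m ; complete = cmp }

  ℕ×-total-suc : ∀ m f → total (sols (suc m)) f
                         ≡ total (solutions W (suc m)) (f ∘ (0 ,_)) ℤ.+ total (sols m) (f ∘ map₁ suc)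
  ℕ×-total-suc m f = trans
    (total-++ (List.map (0 ,_) (solutions W (suc m))) _ f)
    (cong₂ ℤ._+_ (total-map (0 ,_) (solutions W (suc m)) f) (total-map (map₁ suc) (sols m) f))

  ℕ×-peelˡ : Peel ℕ× (map₁ suc) 1 ((_≡ 0) ∘ proj₁)
  ℕ×-peelˡ = peeling λ
    { f p zero    → trans (total-map (0 ,_) (solutions W 0) f)
                          (total-0 (solutions W 0) (λ i → p (0 , i) refl))
    ; f p (suc m) → trans (ℕ×-total-suc m f) (trans
        (cong (ℤ._+ total (sols m) (f ∘ map₁ suc)) (total-0 (solutions W (suc m)) (λ i → p (0 , i) refl)))
        (ℤₚ.+-identityˡ _)) }

  -- C sums along antidiagonals, C u m = Σ_{i ≤ m} u i (m - i).
  private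
    C : (ℕ → ℕ → ℤ) → ℕ → ℤ
    C u zero    = u 0 0
    C u (suc m) = u 0 (suc m) ℤ.+ C (u ∘ suc) m

    total-C : ∀ m f → total (sols m) f ≡ C (λ k r → total (solutions W r) (f ∘ (k ,_))) m
    total-C zero    f = total-map (0 ,_) (solutions W 0) f
    total-C (suc m) f = trans (ℕ×-total-suc m f)
      (cong (ℤ._+_ (total (solutions W (suc m)) (f ∘ (0 ,_)))) (total-C m (f ∘ map₁ suc)))

    C-cong : ∀ m {u v} → (∀ k → u k ≗ v k) → C u m ≡ C v m
    C-cong zero    p = p 0 0
    C-cong (suc m) p = cong₂ ℤ._+_ (p 0 (suc m)) (C-cong m (p ∘ suc))

    C-shift₁ : ∀ m u → C (shift 0ℤ 1 ∘ u) m ≡ shift 0ℤ 1 (C u) m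
    C-shift₁ zero          u = refl
    C-shift₁ (suc zero)    u = ℤₚ.+-identityʳ _
    C-shift₁ (suc (suc m)) u = cong (ℤ._+_ (u 0 (suc m))) (C-shift₁ (suc m) (u ∘ suc))

    C-shift : ∀ d m u → C (shift 0ℤ d ∘ u) m ≡ shift 0ℤ d (C u) m
    C-shift zero    m u = refl
    C-shift (suc d) m u = begin
      C (shift 0ℤ (suc d) ∘ u) m         ≡⟨ C-cong m (λ k r → sym (shift-+ 0ℤ 1 d (u k) r)) ⟩
      C (shift 0ℤ 1 ∘ shift 0ℤ d ∘ u) m  ≡⟨ C-shift₁ m (shift 0ℤ d ∘ u) ⟩
      shift 0ℤ 1 (C (shift 0ℤ d ∘ u)) m  ≡⟨ ↑-cong 1 (λ k → C-shift d k u) m ⟩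
      shift 0ℤ 1 (shift 0ℤ d (C u)) m    ≡⟨ shift-+ 0ℤ 1 d (C u) m ⟩
      shift 0ℤ (suc d) (C u) m           ∎
      where open ≡-Reasoning

  -- For each fixed first coordinate the claim is the one for `W`; delaying every row by `d` delays
  -- the antidiagonal sums by `d`.
  ℕ×-peelʳ : ∀ {s d Z} → Peel W s d Z → Peel ℕ× (map₂ s) d (Z ∘ proj₂)
  ℕ×-peelʳ {s} {d} W-peel = peeling λ f p m → begin
    total (sols m) f
      ≡⟨ total-C m f ⟩
    C (λ k r → total (solutions W r) (f ∘ (k ,_))) m
      ≡⟨ C-cong m (λ k → peel W-peel (f ∘ (k ,_)) (λ i z → p (k , i) z)) ⟩
    C (λ k → shift 0ℤ d λ r → total (solutions W r) (f ∘ (k ,_) ∘ s)) m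
      ≡⟨ C-shift d m _ ⟩
    shift 0ℤ d (C λ k r → total (solutions W r) (f ∘ (k ,_) ∘ s)) m
      ≡⟨ ↑-cong d (λ k → sym (total-C k (f ∘ map₂ s))) m ⟩
    shift 0ℤ d (λ k → total (sols k) (f ∘ map₂ s)) m
      ∎
    where open ≡-Reasoning

module _ {I : Set} {wt : I → ℕ} (W : Weighting wt) (V : I → ℤ⟦q⟧) where

  shift-eval : ∀ d β (F : ℤ⟦x,q⟧) m n → shift 0ℤ d (λ k → (β ↑ F k) n) m ≡ mono d β F m n
  shift-eval zero    β F m       n = refl
  shift-eval (suc d) β F zero    n = sym (↑-0 β n)
  shift-eval (suc d) β F (suc m) n = shift-eval d β F m n

  -- The factor (1 - q^ c i) cancels from the denominator of V i.
  contiguity : ∀ {s d Z} → Peel W s d Z →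
    ∀ (c : I → ℕ) → (∀ i → Z i → c i ≡ 0) →
    (∀ i n → V (s i) n ≡ (c (s i) ↑ V (s i)) n ℤ.+ V i n) →
    ∀ β (e e′ e″ : I → ℕ) → (∀ i → e′ i ≡ e i + c i) → (∀ i → e (s i) ≡ β + e″ i) →
    series W (λ i → e i ↑ V i) ⟪ 0 , 0 ⟫ ≐
      series W (λ i → e′ i ↑ V i) ⟪ 0 , 0 ⟫ ∷ series W (λ i → e″ i ↑ V i) ⟪ d , β ⟫ ∷ []
  contiguity {s} {d} W-peel c c≡0 V-suc β e e′ e″ e′≡ e∘s≡ .at m n = begin
    total L (λ i → (e i ↑ V i) n)
      ≡⟨ total-cong L (λ {i} _ → lemma ((e i ↑ V i) n) ((e′ i ↑ V i) n)) ⟩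
    total L (λ i → (e′ i ↑ V i) n ℤ.+ f i)
      ≡⟨ total-+ L (λ i → (e′ i ↑ V i) n) f ⟩
    total L (λ i → (e′ i ↑ V i) n) ℤ.+ total L f
      ≡⟨ cong (ℤ._+_ (total L (λ i → (e′ i ↑ V i) n))) (begin
        total L f
          ≡⟨ peel W-peel f f≡0 m ⟩
        shift 0ℤ d (λ k → total (solutions W k) (f ∘ s)) m
          ≡⟨ ↑-cong d (λ k → trans (total-cong (solutions W k) (λ {i} _ → f∘s i))
                                   (sym (total-↑ β (solutions W k) (λ i → e″ i ↑ V i) n))) m ⟩
        shift 0ℤ d (λ k → (β ↑ series W (λ i → e″ i ↑ V i) k) n) m
          ≡⟨ shift-eval d β _ m n ⟩
        mono d β (series W (λ i → e″ i ↑ V i)) m n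
          ∎) ⟩
    total L (λ i → (e′ i ↑ V i) n) ℤ.+ mono d β (series W (λ i → e″ i ↑ V i)) m n
      ≡⟨ cong (ℤ._+_ (total L (λ i → (e′ i ↑ V i) n))) (ℤₚ.+-identityʳ _) ⟨
    total L (λ i → (e′ i ↑ V i) n) ℤ.+ (mono d β (series W (λ i → e″ i ↑ V i)) m n ℤ.+ 0ℤ)
      ∎
    where
    open ≡-Reasoning
    L = solutions W m
    -- The coefficient of q^(e i) (1 - q^(c i)) V i: it vanishes at the indices missed by `s`, and
    -- at `s i` the factor cancels and leaves a multiple of `V i`.
    f : I → ℤ
    f i = (e i ↑ V i) n ℤ.- (e′ i ↑ V i) n
    lemma : ∀ x y → x ≡ y ℤ.+ (x ℤ.- y)
    lemma = ℤ-Solver.solve-∀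
    lemma′ : ∀ x y → x ℤ.+ y ℤ.- x ≡ y
    lemma′ = ℤ-Solver.solve-∀
    f≡0 : ∀ i → _ → f i ≡ 0ℤ
    f≡0 i z = trans
      (cong (λ k → (e i ↑ V i) n ℤ.- (k ↑ V i) n)
            (trans (e′≡ i) (trans (cong (e i +_) (c≡0 i z)) (ℕₚ.+-identityʳ (e i)))))
      (ℤₚ.+-inverseʳ ((e i ↑ V i) n))
    f∘s : ∀ i → f (s i) ≡ (β ↑ e″ i ↑ V i) n
    f∘s i = begin
      (e (s i) ↑ V (s i)) n ℤ.- (e′ (s i) ↑ V (s i)) n
        ≡⟨ cong₂ ℤ._-_ (trans (↑-cong (e (s i)) (V-suc i) n) (↑-linear (e (s i)) (c (s i) ↑ V (s i)) (V i) n))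
                       (trans (cong (λ k → (k ↑ V (s i)) n) (e′≡ (s i)))
                              (sym (shift-+ 0ℤ (e (s i)) (c (s i)) (V (s i)) n))) ⟩
      (e (s i) ↑ c (s i) ↑ V (s i)) n ℤ.+ (e (s i) ↑ V i) n ℤ.- (e (s i) ↑ c (s i) ↑ V (s i)) n
        ≡⟨ lemma′ ((e (s i) ↑ c (s i) ↑ V (s i)) n) _ ⟩
      (e (s i) ↑ V i) n
        ≡⟨ cong (λ k → (k ↑ V i) n) (e∘s≡ i) ⟩
      ((β + e″ i) ↑ V i) n
        ≡⟨ shift-+ 0ℤ β (e″ i) (V i) n ⟨
      (β ↑ e″ i ↑ V i) n
        ∎

-- The substitution x ↦ x q^c.
dilate : ℕ → ℤ⟦x,q⟧ → ℤ⟦x,q⟧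
dilate c F m = (m * c) ↑ F m

series-dilate : ∀ {I : Set} {wt : I → ℕ} (W : Weighting wt) (V : I → ℤ⟦q⟧) c (e e′ : I → ℕ) →
  (∀ i → e′ i ≡ wt i * c + e i) →
  series W (λ i → e′ i ↑ V i) ≈ dilate c (series W (λ i → e i ↑ V i))
series-dilate W V c e e′ p m n = trans
  (total-cong (solutions W m) (λ {i} i∈ → trans
    (cong (λ k → (k ↑ V i) n) (trans (p i) (cong (λ k → k * c + e i) (sound W i∈))))
    (sym (shift-+ 0ℤ (m * c) (e i) (V i) n))))
  (sym (total-↑ (m * c) (solutions W m) (λ i → e i ↑ V i) n))

-- The double series

pairs : Weighting {ℕ × ℕ} (λ (i , j) → i + 2 * j)
pairs = ℕ× doubles

denom₂ : ℕ × ℕ → ℤ⟦q⟧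
denom₂ (i , j) = ⟨ 1 ⟩ i ⊗ ⟨ 3 ⟩ j

denom₂-unit : ∀ p → denom₂ p 0 ≡ 1ℤ
denom₂-unit (i , j) = ⊗-unit (⟨ 1 ⟩ i) (⟨ 3 ⟩ j) (⟨⟩-unit 0 i) (⟨⟩-unit 2 j)

recip₂ : ℕ × ℕ → ℤ⟦q⟧
recip₂ p = q^ 0 ⊘ denom₂ p

expo₂ : ℕ → ℕ → ℕ × ℕ → ℕ
expo₂ a b (i , j) = 2 * (i * i) + 6 * (i * j) + 6 * (j * j) + a * i + b * j

S : ℕ → ℕ → ℤ⟦x,q⟧
S a b = series pairs (λ p → expo₂ a b p ↑ recip₂ p)

-- Passing from i to i + 1 adds 4i + 6j + 2 + a to the exponent and 1 to the weight, which gives the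
-- index shifts 4 and 6 and the monomial x q^(2 + a).
S-step₁ : ∀ a b → S a b ⟪ 0 , 0 ⟫ ≐ S (1 + a) b ⟪ 0 , 0 ⟫ ∷ S (4 + a) (6 + b) ⟪ 1 , 2 + a ⟫ ∷ []
S-step₁ a b = contiguity pairs recip₂ (ℕ×-peelˡ doubles) (λ (i , _) → i * 1) (λ { _ refl → refl })
  (λ (i , j) → ⊘-extend (denom₂ (i , j)) (denom₂ (suc i , j)) (suc i * 1) (denom₂-unit (i , j)) (denom₂-unit (suc i , j))
                 (⊗-growˡ (⟨ 1 ⟩ i) (⟨ 3 ⟩ j) (q^ 0 ⊖ q^ (suc i * 1)) (⟨⟩-suc 1 i)))
  (2 + a) (expo₂ a b) (expo₂ (1 + a) b) (expo₂ (4 + a) (6 + b))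
  (λ (i , j) → raise a b i j) (λ (i , j) → next a b i j)
  where
  raise : ∀ a b i j →
    2 * (i * i) + 6 * (i * j) + 6 * (j * j) + (1 + a) * i + b * j
    ≡ 2 * (i * i) + 6 * (i * j) + 6 * (j * j) + a * i + b * j + i * 1
  raise = ℕ-Solver.solve-∀
  next : ∀ a b i j →
    2 * ((suc i) * (suc i)) + 6 * ((suc i) * j) + 6 * (j * j) + a * (suc i) + b * j
    ≡ 2 + a + (2 * (i * i) + 6 * (i * j) + 6 * (j * j) + (4 + a) * i + (6 + b) * j)
  next = ℕ-Solver.solve-∀

-- Passing from j to j + 1 adds 6i + 12j + 6 + b to the exponent and 2 to the weight.
S-step₂ : ∀ a b → S a b ⟪ 0 , 0 ⟫ ≐ S a (3 + b) ⟪ 0 , 0 ⟫ ∷ S (6 + a) (12 + b) ⟪ 2 , 6 + b ⟫ ∷ []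
S-step₂ a b = contiguity pairs recip₂ (ℕ×-peelʳ doubles doubles-peel) (λ (_ , j) → j * 3) (λ { _ refl → refl })
  (λ (i , j) → ⊘-extend (denom₂ (i , j)) (denom₂ (i , suc j)) (suc j * 3) (denom₂-unit (i , j)) (denom₂-unit (i , suc j))
                 (⊗-growʳ (⟨ 1 ⟩ i) (⟨ 3 ⟩ j) (q^ 0 ⊖ q^ (suc j * 3)) (⟨⟩-suc 3 j)))
  (6 + b) (expo₂ a b) (expo₂ a (3 + b)) (expo₂ (6 + a) (12 + b))
  (λ (i , j) → raise a b i j) (λ (i , j) → next a b i j)
  where
  raise : ∀ a b i j →
    2 * (i * i) + 6 * (i * j) + 6 * (j * j) + a * i + (3 + b) * j
    ≡ 2 * (i * i) + 6 * (i * j) + 6 * (j * j) + a * i + b * j + j * 3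
  raise = ℕ-Solver.solve-∀
  next : ∀ a b i j →
    2 * (i * i) + 6 * (i * (suc j)) + 6 * ((suc j) * (suc j)) + a * i + b * (suc j)
    ≡ 6 + b + (2 * (i * i) + 6 * (i * j) + 6 * (j * j) + (6 + a) * i + (12 + b) * j)
  next = ℕ-Solver.solve-∀

S-dilate : ∀ t a b → S (t * 3 + a) (t * 6 + b) ≈ dilate (t * 3) (S a b)
S-dilate t a b = series-dilate pairs recip₂ (t * 3) (expo₂ a b) (expo₂ (t * 3 + a) (t * 6 + b)) (λ (i , j) → lemma t a b i j)
  where
  lemma : ∀ t a b i j →
    2 * (i * i) + 6 * (i * j) + 6 * (j * j) + (t * 3 + a) * i + (t * 6 + b) * j
    ≡ (i + 2 * j) * (t * 3) + (2 * (i * i) + 6 * (i * j) + 6 * (j * j) + a * i + b * j)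
  lemma = ℕ-Solver.solve-∀

-- The constants stand in front of the multiples of t so that the indices of `G (1 + t)` and
-- `H (1 + t)` reduce to the shifted ones that the contiguity relations produce.
G H : ℕ → ℤ⟦x,q⟧
G t = S (t * 3) (t * 6)
H t = S (1 + t * 3) (3 + t * 6)

G-rec : ∀ t → G t ⟪ 0 , 0 ⟫ ≐ H t ⟪ 0 , 0 ⟫ ∷ H (1 + t) ⟪ 1 , 2 + t * 3 ⟫ ∷ G (2 + t) ⟪ 2 , 6 + t * 6 ⟫ ∷ []
G-rec t = combine (S-step₂ (t * 3) (t * 6)) (S-step₁ (t * 3) (3 + t * 6))
  where
  lemma : ∀ h xh xg → h ℤ.+ (xh ℤ.+ 0ℤ) ℤ.+ (xg ℤ.+ 0ℤ) ≡ h ℤ.+ (xh ℤ.+ (xg ℤ.+ 0ℤ))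
  lemma = ℤ-Solver.solve-∀
  -- The terms are abstract here and unification identifies the shared ones. Rewriting with the
  -- relations at a fixed coefficient eliminates the auxiliary terms and leaves an identity of
  -- integers.
  combine : ∀ {g r h xh xg} → g ≐ r ∷ xg ∷ [] → r ≐ h ∷ xh ∷ [] → g ≐ h ∷ xh ∷ xg ∷ []
  combine {h = h} {xh} {xg} p₁ p₂ .at m n
    rewrite at p₁ m n | at p₂ m n = lemma (⟦ h ⟧ m n) (⟦ xh ⟧ m n) (⟦ xg ⟧ m n)

-- Raising the indices of `H t` to those of `G (1 + t)` leaves remainders u and v beside the wanted
-- terms. The same u and v make up `w′`, the remainder that turns `w` into x q^(3 + 3t) `H (1 + t)`.
H-rec : ∀ t → H t ⟪ 0 , 0 ⟫ ≐ G (1 + t) ⟪ 0 , 0 ⟫ ∷ G (2 + t) ⟪ 1 , 4 + t * 3 ⟫ ∷ H (1 + t) ⟪ 1 , 3 + t * 3 ⟫ ∷ []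
H-rec t = combine
  (S-step₁ (1 + a) (3 + b))
  (S-step₁ (2 + a) (3 + b))
  -- Here b = 2a enters: the q-exponents of u and v are rewritten to the expressions in which they
  -- reappear in the last two relations.
  (subst (λ k → S (3 + a) (3 + b) ⟪ 0 , 0 ⟫ ≐ S (3 + a) (6 + b) ⟪ 0 , 0 ⟫ ∷ S (9 + a) (15 + b) ⟪ 2 , k ⟫ ∷ [])
    (expo₉ t) (S-step₂ (3 + a) (3 + b)))
  (subst (λ k → S (6 + a) (9 + b) ⟪ 1 , 4 + a ⟫ ≐ S (6 + a) (12 + b) ⟪ 1 , 4 + a ⟫ ∷ S (12 + a) (21 + b) ⟪ 3 , k ⟫ ∷ [])
    (expo₁₉ t) (scaled 1 (4 + a) (S-step₂ (6 + a) (9 + b))))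
  (scaled 1 (3 + a) (S-step₁ (4 + a) (9 + b)))
  (scaled 2 (6 + a + (3 + a)) (S-step₁ (8 + a) (15 + b)))
  where
  a = t * 3
  b = t * 6
  expo₉ : ∀ t → 9 + t * 6 ≡ 6 + t * 3 + (3 + t * 3)
  expo₉ = ℕ-Solver.solve-∀
  expo₁₉ : ∀ t → 15 + t * 6 + (4 + t * 3) ≡ 10 + t * 3 + (6 + t * 3 + (3 + t * 3))
  expo₁₉ = ℕ-Solver.solve-∀
  lemma : ∀ g₁ xg₂ u v w →
    g₁ ℤ.+ (u ℤ.+ 0ℤ) ℤ.+ (xg₂ ℤ.+ (v ℤ.+ 0ℤ) ℤ.+ 0ℤ) ℤ.+ (w ℤ.+ 0ℤ)
    ≡ g₁ ℤ.+ (xg₂ ℤ.+ (w ℤ.+ (u ℤ.+ (v ℤ.+ 0ℤ) ℤ.+ 0ℤ) ℤ.+ 0ℤ))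
  lemma = ℤ-Solver.solve-∀
  combine : ∀ {h r s g₁ xr xg₂ xh₁ u v w w′} →
    h ≐ r ∷ w ∷ [] → r ≐ s ∷ xr ∷ [] → s ≐ g₁ ∷ u ∷ [] → xr ≐ xg₂ ∷ v ∷ [] →
    xh₁ ≐ w ∷ w′ ∷ [] → w′ ≐ u ∷ v ∷ [] → h ≐ g₁ ∷ xg₂ ∷ xh₁ ∷ []
  combine {g₁ = g₁} {xg₂ = xg₂} {u = u} {v = v} {w = w} p₁ p₂ p₃ p₄ p₅ p₆ .at m n
    rewrite at p₁ m n | at p₂ m n | at p₃ m n | at p₄ m n | at p₅ m n | at p₆ m n
    = lemma (⟦ g₁ ⟧ m n) (⟦ xg₂ ⟧ m n) (⟦ u ⟧ m n) (⟦ v ⟧ m n) (⟦ w ⟧ m n)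

-- The q-difference equation

QDifference : (ℕ → ℤ⟦x,q⟧) → Set
QDifference F = F 0 ⊕ mono 3 15 (F 3) ≈
  F 1 ⊕ mono 1 3 (F 1) ⊕ mono 1 1 (F 2) ⊕ mono 1 5 (F 2) ⊕ mono 2 6 (F 2) ⊕ mono 2 9 (F 3)

-- For the coefficient f of xᵐ with m > 0 the equation reads (1 - q^(3m)) f = an expression in
-- coefficients of lower powers of x. The outer induction settles the right-hand side; the inner
-- one, on the power of q, inverts 1 - q^(3m).
QDifference-unique : ∀ F F′ → QDifference F → QDifference F′ →
  (∀ t → F t ≈ dilate (t * 3) (F 0)) → (∀ t → F′ t ≈ dilate (t * 3) (F′ 0)) →
  F 0 0 ≗ F′ 0 0 → F 0 ≈ F′ 0
QDifference-unique F F′ eqF eqF′ dilF dilF′ eq₀ =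
  <-rec (λ m → F 0 m ≗ F′ 0 m) λ
    { zero    _   → eq₀
    ; (suc m) ihₘ → <-rec (λ n → F 0 (suc m) n ≡ F′ 0 (suc m) n) λ n ihₙ →
        let
          below : ∀ α β t → mono (suc α) β (F t) (suc m) n ≡ mono (suc α) β (F′ t) (suc m) n
          below α β t = mono-local (suc α) β (suc m) n λ k le n′ →
            trans (dilF t k n′) (trans (↑-cong (k * (t * 3)) (ihₘ (ℕₚ.≤-trans (k<k+1+α k α) le)) n′)
                                       (sym (dilF′ t k n′)))
          -- The only term on the right without a factor x; dilation still delays it by 3(m + 1) > 0
          -- in q.
          same₁ : F 1 (suc m) n ≡ F′ 1 (suc m) n
          same₁ = trans (dilF 1 (suc m) n) (trans
            (↑-local (suc m * 3) n (λ k le → ihₙ (ℕₚ.≤-trans (k<k+1+α k _) le)))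
            (sym (dilF′ 1 (suc m) n)))
        in +-cancelʳ (mono 3 15 (F 3) (suc m) n) _ _ (trans (eqF (suc m) n) (trans
             (cong₂ ℤ._+_ (cong₂ ℤ._+_ (cong₂ ℤ._+_ (cong₂ ℤ._+_ (cong₂ ℤ._+_
               same₁ (below 0 3 1)) (below 0 1 2)) (below 0 5 2)) (below 1 6 2)) (below 1 9 3))
             (trans (sym (eqF′ (suc m) n)) (cong (ℤ._+_ (F′ 0 (suc m) n)) (sym (below 2 15 3)))))) }
  where
  k<k+1+α : ∀ k α → k < k + suc α
  k<k+1+α k α = subst (k <_) (sym (ℕₚ.+-suc k α)) (s≤s (ℕₚ.m≤m+n k α))

-- At t = 0: a partition in 𝒞 without the part 2 has all parts at least 3, or it starts with 1 and
-- continues with parts at least 5, the bound of `G 1`.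
W : ℕ → ℤ⟦x,q⟧
W t = H t ⊕ mono 1 (1 + t * 3) (G (1 + t))

dilate-mono₁ : ∀ c β F → dilate c (mono 1 β F) ≈ mono 1 (β + c) (dilate c F)
dilate-mono₁ c β F zero    n = sym (trans (↑-0 (β + c) n) (sym (↑-0 β n)))
dilate-mono₁ c β F (suc m) n = trans (shift-+ 0ℤ (c + m * c) β (F m) n)
  (trans (cong (λ k → (k ↑ F m) n) (lemma c (m * c) β)) (sym (shift-+ 0ℤ (β + c) (m * c) (F m) n)))
  where
  lemma : ∀ c d β → c + d + β ≡ β + c + d
  lemma = ℕ-Solver.solve-∀

W-dilate : ∀ t → W t ≈ dilate (t * 3) (W 0)
W-dilate t m n = begin
  H t m n ℤ.+ mono 1 (1 + t * 3) (G (1 + t)) m n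
    ≡⟨ cong₂ ℤ._+_ (trans (cong₂ (λ a b → S a b m n) (ℕₚ.+-comm 1 (t * 3)) (ℕₚ.+-comm 3 (t * 6))) (S-dilate t 1 3 m n))
                   (trans (mono-cong 1 (1 + t * 3) G-dilate m n) (sym (dilate-mono₁ (t * 3) 1 (G 1) m n))) ⟩
  dilate (t * 3) (H 0) m n ℤ.+ dilate (t * 3) (mono 1 1 (G 1)) m n
    ≡⟨ ↑-linear (m * (t * 3)) (H 0 m) (mono 1 1 (G 1) m) n ⟨
  dilate (t * 3) (W 0) m n
    ∎
  where
  open ≡-Reasoning
  G-dilate : G (1 + t) ≈ dilate (t * 3) (G 1)
  G-dilate k l = trans (cong₂ (λ a b → S a b k l) (ℕₚ.+-comm 3 (t * 3)) (ℕₚ.+-comm 6 (t * 6))) (S-dilate t 3 6 k l)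

-- The term x q³ `W 1` contains x² q⁷ `G 2`, whereas expanding the left side yields only x² q⁷
-- `H 2`. By `G-rec 2` the surplus is exactly x³ q¹⁵ `W 3`, the origin of the negative term.
W-qDifference : QDifference W
W-qDifference = combine
  (H-rec 0) (G-rec 1) (scaled 1 1 (G-rec 1)) (scaled 1 1 (H-rec 1))
  (scaled 1 1 (G-rec 2)) (scaled 2 7 (G-rec 2))
  (xW 3 15 3) (xW 1 3 1) (xW 1 1 2) (xW 1 5 2) (xW 2 6 2) (xW 2 9 3)
  where
  xW : ∀ α β t → W t ⟪ α , β ⟫ ≐ H t ⟪ α , β ⟫ ∷ G (1 + t) ⟪ 1 + α , 1 + t * 3 + β ⟫ ∷ []
  xW α β t = scaled α β {W t ⟪ 0 , 0 ⟫} {H t ⟪ 0 , 0 ⟫ ∷ G (1 + t) ⟪ 1 , 1 + t * 3 ⟫ ∷ []}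
    (pointwise λ m n → cong (ℤ._+_ (H t m n)) (sym (ℤₚ.+-identityʳ _)))
  lemma : ∀ a b c d e f g h i j k l o p →
    c ℤ.+ (d ℤ.+ (e ℤ.+ 0ℤ)) ℤ.+ (a ℤ.+ (b ℤ.+ 0ℤ))
      ℤ.+ (j ℤ.+ (k ℤ.+ (l ℤ.+ 0ℤ)) ℤ.+ (h ℤ.+ (i ℤ.+ 0ℤ)) ℤ.+ (f ℤ.+ (g ℤ.+ 0ℤ))) ℤ.+ (o ℤ.+ (p ℤ.+ 0ℤ))
    ≡ c ℤ.+ a ℤ.+ (b ℤ.+ (i ℤ.+ (o ℤ.+ (p ℤ.+ 0ℤ)) ℤ.+ 0ℤ)) ℤ.+ (j ℤ.+ (h ℤ.+ 0ℤ)) ℤ.+ (d ℤ.+ (e ℤ.+ 0ℤ))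
      ℤ.+ (f ℤ.+ (g ℤ.+ 0ℤ)) ℤ.+ (k ℤ.+ (l ℤ.+ 0ℤ))
  lemma = ℤ-Solver.solve-∀
  -- The subscript of x in these names is the exponent of q; the exponent of x is left out.
  combine : ∀ {h₀ g₁ x₄g₂ x₃h₁ h₁ x₅h₂ x₁₂g₃ x₁g₁ x₁h₁ x₆h₂ x₁₃g₃ x₁g₂ x₈g₃ x₇h₂ x₁h₂ x₉h₃ x₁₉g₄
               x₇g₂ x₁₅h₃ x₂₅g₄ x₁₅w₃ x₃w₁ x₁w₂ x₅w₂ x₆w₂ x₉w₃} →
    h₀ ≐ g₁ ∷ x₄g₂ ∷ x₃h₁ ∷ [] → g₁ ≐ h₁ ∷ x₅h₂ ∷ x₁₂g₃ ∷ [] → x₁g₁ ≐ x₁h₁ ∷ x₆h₂ ∷ x₁₃g₃ ∷ [] →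
    x₁h₁ ≐ x₁g₂ ∷ x₈g₃ ∷ x₇h₂ ∷ [] → x₁g₂ ≐ x₁h₂ ∷ x₉h₃ ∷ x₁₉g₄ ∷ [] → x₇g₂ ≐ x₇h₂ ∷ x₁₅h₃ ∷ x₂₅g₄ ∷ [] →
    x₁₅w₃ ≐ x₁₅h₃ ∷ x₂₅g₄ ∷ [] → x₃w₁ ≐ x₃h₁ ∷ x₇g₂ ∷ [] → x₁w₂ ≐ x₁h₂ ∷ x₈g₃ ∷ [] →
    x₅w₂ ≐ x₅h₂ ∷ x₁₂g₃ ∷ [] → x₆w₂ ≐ x₆h₂ ∷ x₁₃g₃ ∷ [] → x₉w₃ ≐ x₉h₃ ∷ x₁₉g₄ ∷ [] →
    ⟦ h₀ ⟧ ⊕ ⟦ x₁g₁ ⟧ ⊕ ⟦ x₁₅w₃ ⟧ ≈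
      ⟦ h₁ ⟧ ⊕ ⟦ x₄g₂ ⟧ ⊕ ⟦ x₃w₁ ⟧ ⊕ ⟦ x₁w₂ ⟧ ⊕ ⟦ x₅w₂ ⟧ ⊕ ⟦ x₆w₂ ⟧ ⊕ ⟦ x₉w₃ ⟧
  combine {x₄g₂ = a} {x₃h₁ = b} {h₁ = c} {x₅h₂ = d} {x₁₂g₃ = e} {x₆h₂ = f} {x₁₃g₃ = g} {x₈g₃ = h} {x₇h₂ = i}
          {x₁h₂ = j} {x₉h₃ = k} {x₁₉g₄ = l} {x₁₅h₃ = o} {x₂₅g₄ = p}
          p₁ p₂ p₃ p₄ p₅ p₆ p₇ p₈ p₉ p₁₀ p₁₁ p₁₂ m n
    rewrite at p₁ m n | at p₂ m n | at p₃ m n | at p₄ m n | at p₅ m n | at p₇ m n | at p₈ m n | at p₆ m n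
          | at p₉ m n | at p₁₀ m n | at p₁₁ m n | at p₁₂ m n
    = lemma (⟦ a ⟧ m n) (⟦ b ⟧ m n) (⟦ c ⟧ m n) (⟦ d ⟧ m n) (⟦ e ⟧ m n) (⟦ f ⟧ m n) (⟦ g ⟧ m n)
            (⟦ h ⟧ m n) (⟦ i ⟧ m n) (⟦ j ⟧ m n) (⟦ k ⟧ m n) (⟦ l ⟧ m n) (⟦ o ⟧ m n) (⟦ p ⟧ m n)

-- The fourfold series

-- The number n (n - 1) / 2 without division, so that exponents stay polynomial in it and unfold
-- along `suc`.
tri : ℕ → ℕ
tri zero    = 0
tri (suc n) = n + tri n

3n[n∸1]/2 : ∀ n → 3 * n * (n ∸ 1) / 2 ≡ 3 * tri n
3n[n∸1]/2 n = trans (cong (_/ 2) (doubled n)) (m*n/n≡m (3 * tri n) 2)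
  where
  lemma : ∀ n t → 3 * suc (suc n) * suc n ≡ 3 * suc n * n + 6 * suc n
  lemma = ℕ-Solver.solve-∀
  lemma′ : ∀ n t → 3 * t * 2 + 6 * suc n ≡ 3 * (suc n + t) * 2
  lemma′ = ℕ-Solver.solve-∀
  doubled : ∀ n → 3 * n * (n ∸ 1) ≡ 3 * tri n * 2
  doubled zero          = refl
  doubled (suc zero)    = refl
  doubled (suc (suc n)) = trans (lemma n 0)
    (trans (cong (_+ 6 * suc n) (doubled (suc n))) (lemma′ n (tri (suc n))))

quads : Weighting {ℕ × ℕ × ℕ × ℕ} (λ (i , j , k , l) → i + (j + (k + 2 * l)))
quads = ℕ× (ℕ× (ℕ× doubles))

denom₄ : ℕ × ℕ × ℕ × ℕ → ℤ⟦q⟧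
denom₄ (i , j , k , l) = ⟨ 3 ⟩ i ⊗ ⟨ 3 ⟩ j ⊗ ⟨ 3 ⟩ k ⊗ ⟨ 6 ⟩ l

denom₄-unit : ∀ p → denom₄ p 0 ≡ 1ℤ
denom₄-unit (i , j , k , l) =
  ⊗-unit (⟨ 3 ⟩ i ⊗ ⟨ 3 ⟩ j ⊗ ⟨ 3 ⟩ k) (⟨ 6 ⟩ l)
    (⊗-unit (⟨ 3 ⟩ i ⊗ ⟨ 3 ⟩ j) (⟨ 3 ⟩ k)
      (⊗-unit (⟨ 3 ⟩ i) (⟨ 3 ⟩ j) (⟨⟩-unit 2 i) (⟨⟩-unit 2 j))
      (⟨⟩-unit 2 k))
    (⟨⟩-unit 5 l)

recip₄ : ℕ × ℕ × ℕ × ℕ → ℤ⟦q⟧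
recip₄ p = q^ 0 ⊘ denom₄ p

recip₄-extend : ∀ p p′ c → denom₄ p′ ≗ denom₄ p ⊗ (q^ 0 ⊖ q^ c) →
                ∀ n → recip₄ p′ n ≡ (c ↑ recip₄ p′) n ℤ.+ recip₄ p n
recip₄-extend p p′ c = ⊘-extend (denom₄ p) (denom₄ p′) c (denom₄-unit p) (denom₄-unit p′)

expo₄ : ℕ → ℕ → ℕ → ℕ → ℕ × ℕ × ℕ × ℕ → ℕ
expo₄ a b c d (i , j , k , l) =
  3 * tri (i + (j + (k + 2 * l))) + a * i + (b * j + 3 * tri j) + (c * k + 3 * tri k) + d * l

T : ℕ → ℕ → ℕ → ℕ → ℤ⟦x,q⟧
T a b c d = series quads (λ p → expo₄ a b c d p ↑ recip₄ p)

-- Raising R by 1 adds 3R = 3i + 3j + 3k + 6l to the exponent, hence the shifts 3, 3, 3, 6. For j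
-- and k the triangular number of the index itself adds another 3 to its own shift.
T-step₁ : ∀ a b c d → T a b c d ⟪ 0 , 0 ⟫ ≐ T (3 + a) b c d ⟪ 0 , 0 ⟫ ∷ T (3 + a) (3 + b) (3 + c) (6 + d) ⟪ 1 , a ⟫ ∷ []
T-step₁ a b c d = contiguity quads recip₄ (ℕ×-peelˡ (ℕ× (ℕ× doubles))) (λ (i , _) → i * 3) (λ { _ refl → refl })
  (λ (i , j , k , l) → recip₄-extend (i , j , k , l) (suc i , j , k , l) (suc i * 3)
    (⊗-growˡ (⟨ 3 ⟩ i ⊗ ⟨ 3 ⟩ j ⊗ ⟨ 3 ⟩ k) (⟨ 6 ⟩ l) (u i)
      (⊗-growˡ (⟨ 3 ⟩ i ⊗ ⟨ 3 ⟩ j) (⟨ 3 ⟩ k) (u i)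
        (⊗-growˡ (⟨ 3 ⟩ i) (⟨ 3 ⟩ j) (u i) (⟨⟩-suc 3 i)))))
  a (expo₄ a b c d) (expo₄ (3 + a) b c d) (expo₄ (3 + a) (3 + b) (3 + c) (6 + d))
  (λ (i , j , k , l) → raise a b c d i j k l (tri (i + (j + (k + 2 * l)))) (tri j) (tri k))
  (λ (i , j , k , l) → next a b c d i j k l (tri (i + (j + (k + 2 * l)))) (tri j) (tri k))
  where
  u : ℕ → ℤ⟦q⟧
  u i = q^ 0 ⊖ q^ (suc i * 3)
  raise : ∀ a b c d i j k l r s t →
    3 * r + (3 + a) * i + (b * j + 3 * s) + (c * k + 3 * t) + d * l
    ≡ 3 * r + a * i + (b * j + 3 * s) + (c * k + 3 * t) + d * l + i * 3
  raise = ℕ-Solver.solve-∀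
  next : ∀ a b c d i j k l r s t →
    3 * (i + (j + (k + 2 * l)) + r) + a * suc i + (b * j + 3 * s) + (c * k + 3 * t) + d * l
    ≡ a + (3 * r + (3 + a) * i + ((3 + b) * j + 3 * s) + ((3 + c) * k + 3 * t) + (6 + d) * l)
  next = ℕ-Solver.solve-∀

T-step₂ : ∀ a b c d → T a b c d ⟪ 0 , 0 ⟫ ≐ T a (3 + b) c d ⟪ 0 , 0 ⟫ ∷ T (3 + a) (6 + b) (3 + c) (6 + d) ⟪ 1 , b ⟫ ∷ []
T-step₂ a b c d = contiguity quads recip₄ (ℕ×-peelʳ (ℕ× (ℕ× doubles)) (ℕ×-peelˡ (ℕ× doubles))) (λ (_ , j , _) → j * 3) (λ { _ refl → refl })
  (λ (i , j , k , l) → recip₄-extend (i , j , k , l) (i , suc j , k , l) (suc j * 3)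
    (⊗-growˡ (⟨ 3 ⟩ i ⊗ ⟨ 3 ⟩ j ⊗ ⟨ 3 ⟩ k) (⟨ 6 ⟩ l) (u j)
      (⊗-growˡ (⟨ 3 ⟩ i ⊗ ⟨ 3 ⟩ j) (⟨ 3 ⟩ k) (u j)
        (⊗-growʳ (⟨ 3 ⟩ i) (⟨ 3 ⟩ j) (u j) (⟨⟩-suc 3 j)))))
  b (expo₄ a b c d) (expo₄ a (3 + b) c d) (expo₄ (3 + a) (6 + b) (3 + c) (6 + d))
  (λ (i , j , k , l) → raise a b c d i j k l (tri (i + (j + (k + 2 * l)))) (tri j) (tri k))
  -- The successor has to be brought to the head of R before `tri` unfolds.
  (λ (i , j , k , l) → trans (cong (λ R → 3 * tri R + a * i + (b * suc j + 3 * tri (suc j)) + (c * k + 3 * tri k) + d * l)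
                                   (ℕₚ.+-suc i (j + (k + 2 * l))))
                             (next a b c d i j k l (tri (i + (j + (k + 2 * l)))) (tri j) (tri k)))
  where
  u : ℕ → ℤ⟦q⟧
  u i = q^ 0 ⊖ q^ (suc i * 3)
  raise : ∀ a b c d i j k l r s t →
    3 * r + a * i + ((3 + b) * j + 3 * s) + (c * k + 3 * t) + d * l
    ≡ 3 * r + a * i + (b * j + 3 * s) + (c * k + 3 * t) + d * l + j * 3
  raise = ℕ-Solver.solve-∀
  next : ∀ a b c d i j k l r s t →
    3 * (i + (j + (k + 2 * l)) + r) + a * i + (b * suc j + 3 * (j + s)) + (c * k + 3 * t) + d * l
    ≡ b + (3 * r + (3 + a) * i + ((6 + b) * j + 3 * s) + ((3 + c) * k + 3 * t) + (6 + d) * l)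
  next = ℕ-Solver.solve-∀

T-step₃ : ∀ a b c d → T a b c d ⟪ 0 , 0 ⟫ ≐ T a b (3 + c) d ⟪ 0 , 0 ⟫ ∷ T (3 + a) (3 + b) (6 + c) (6 + d) ⟪ 1 , c ⟫ ∷ []
T-step₃ a b c d = contiguity quads recip₄ (ℕ×-peelʳ (ℕ× (ℕ× doubles)) (ℕ×-peelʳ (ℕ× doubles) (ℕ×-peelˡ doubles))) (λ (_ , _ , k , _) → k * 3) (λ { _ refl → refl })
  (λ (i , j , k , l) → recip₄-extend (i , j , k , l) (i , j , suc k , l) (suc k * 3)
    (⊗-growˡ (⟨ 3 ⟩ i ⊗ ⟨ 3 ⟩ j ⊗ ⟨ 3 ⟩ k) (⟨ 6 ⟩ l) (u k)
      (⊗-growʳ (⟨ 3 ⟩ i ⊗ ⟨ 3 ⟩ j) (⟨ 3 ⟩ k) (u k) (⟨⟩-suc 3 k))))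
  c (expo₄ a b c d) (expo₄ a b (3 + c) d) (expo₄ (3 + a) (3 + b) (6 + c) (6 + d))
  (λ (i , j , k , l) → raise a b c d i j k l (tri (i + (j + (k + 2 * l)))) (tri j) (tri k))
  (λ (i , j , k , l) → trans (cong (λ R → 3 * tri R + a * i + (b * j + 3 * tri j) + (c * suc k + 3 * tri (suc k)) + d * l)
                                   (trans (cong (i +_) (ℕₚ.+-suc j (k + 2 * l))) (ℕₚ.+-suc i (j + (k + 2 * l)))))
                             (next a b c d i j k l (tri (i + (j + (k + 2 * l)))) (tri j) (tri k)))
  where
  u : ℕ → ℤ⟦q⟧
  u i = q^ 0 ⊖ q^ (suc i * 3)
  raise : ∀ a b c d i j k l r s t →
    3 * r + a * i + (b * j + 3 * s) + ((3 + c) * k + 3 * t) + d * l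
    ≡ 3 * r + a * i + (b * j + 3 * s) + (c * k + 3 * t) + d * l + k * 3
  raise = ℕ-Solver.solve-∀
  next : ∀ a b c d i j k l r s t →
    3 * (i + (j + (k + 2 * l)) + r) + a * i + (b * j + 3 * s) + (c * suc k + 3 * (k + t)) + d * l
    ≡ c + (3 * r + (3 + a) * i + ((3 + b) * j + 3 * s) + ((6 + c) * k + 3 * t) + (6 + d) * l)
  next = ℕ-Solver.solve-∀

-- Raising l raises R by 2, and 3 `tri` R grows by 6R + 3; this doubles the shifts and accounts for
-- the constant 3.
T-step₄ : ∀ a b c d → T a b c d ⟪ 0 , 0 ⟫ ≐ T a b c (6 + d) ⟪ 0 , 0 ⟫ ∷ T (6 + a) (6 + b) (6 + c) (12 + d) ⟪ 2 , 3 + d ⟫ ∷ []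
T-step₄ a b c d = contiguity quads recip₄ (ℕ×-peelʳ (ℕ× (ℕ× doubles)) (ℕ×-peelʳ (ℕ× doubles) (ℕ×-peelʳ doubles doubles-peel))) (λ (_ , _ , _ , l) → l * 6) (λ { _ refl → refl })
  (λ (i , j , k , l) → recip₄-extend (i , j , k , l) (i , j , k , suc l) (suc l * 6)
    (⊗-growʳ (⟨ 3 ⟩ i ⊗ ⟨ 3 ⟩ j ⊗ ⟨ 3 ⟩ k) (⟨ 6 ⟩ l) (q^ 0 ⊖ q^ (suc l * 6)) (⟨⟩-suc 6 l)))
  (3 + d) (expo₄ a b c d) (expo₄ a b c (6 + d)) (expo₄ (6 + a) (6 + b) (6 + c) (12 + d))
  (λ (i , j , k , l) → raise a b c d i j k l (tri (i + (j + (k + 2 * l)))) (tri j) (tri k))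
  (λ (i , j , k , l) → trans (cong (λ R → 3 * tri R + a * i + (b * j + 3 * tri j) + (c * k + 3 * tri k) + d * suc l)
                                   (weight i j k l))
                             (next a b c d i j k l (tri (i + (j + (k + 2 * l)))) (tri j) (tri k)))
  where
  weight : ∀ i j k l → i + (j + (k + 2 * suc l)) ≡ 2 + (i + (j + (k + 2 * l)))
  weight = ℕ-Solver.solve-∀
  raise : ∀ a b c d i j k l r s t →
    3 * r + a * i + (b * j + 3 * s) + (c * k + 3 * t) + (6 + d) * l
    ≡ 3 * r + a * i + (b * j + 3 * s) + (c * k + 3 * t) + d * l + l * 6
  raise = ℕ-Solver.solve-∀
  next : ∀ a b c d i j k l r s t →
    3 * (1 + (i + (j + (k + 2 * l))) + (i + (j + (k + 2 * l)) + r)) + a * i + (b * j + 3 * s) + (c * k + 3 * t) + d * suc l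
    ≡ 3 + d + (3 * r + (6 + a) * i + ((6 + b) * j + 3 * s) + ((6 + c) * k + 3 * t) + (12 + d) * l)
  next = ℕ-Solver.solve-∀

T-dilate : ∀ t a b c d → T (t * 3 + a) (t * 3 + b) (t * 3 + c) (t * 6 + d) ≈ dilate (t * 3) (T a b c d)
T-dilate t a b c d = series-dilate quads recip₄ (t * 3) (expo₄ a b c d) (expo₄ (t * 3 + a) (t * 3 + b) (t * 3 + c) (t * 6 + d))
  (λ (i , j , k , l) → lemma t a b c d i j k l (tri (i + (j + (k + 2 * l)))) (tri j) (tri k))
  where
  lemma : ∀ t a b c d i j k l r s v →
    3 * r + (t * 3 + a) * i + ((t * 3 + b) * j + 3 * s) + ((t * 3 + c) * k + 3 * v) + (t * 6 + d) * l
    ≡ (i + (j + (k + 2 * l))) * (t * 3) + (3 * r + a * i + (b * j + 3 * s) + (c * k + 3 * v) + d * l)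
  lemma = ℕ-Solver.solve-∀

U : ℕ → ℤ⟦x,q⟧
U t = T (t * 3 + 3) (t * 3 + 5) (t * 3 + 1) (t * 6 + 3)

-- Raising each of the four indices of `U 0` once gives `U 1`. Two remainders are not of the form
-- `U t` and need one further step each; the one from l has its first index too large by 3, which
-- produces the term x³ q¹⁵ `U 3`.
U-qDifference : QDifference U
U-qDifference = combine
  (T-step₁ 3 5 1 3) (T-step₄ 6 5 1 3) (T-step₂ 6 5 1 9) (T-step₃ 6 8 1 9)
  (scaled 1 5 (T-step₃ 9 11 4 15)) (scaled 2 6 (T-step₁ 9 11 7 15))
  where
  lemma : ∀ a b c d e f g →
    a ℤ.+ (b ℤ.+ 0ℤ) ℤ.+ (c ℤ.+ (d ℤ.+ 0ℤ) ℤ.+ 0ℤ) ℤ.+ (e ℤ.+ 0ℤ) ℤ.+ (f ℤ.+ 0ℤ) ℤ.+ g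
    ≡ a ℤ.+ f ℤ.+ b ℤ.+ c ℤ.+ (e ℤ.+ (g ℤ.+ 0ℤ)) ℤ.+ d
  lemma = ℤ-Solver.solve-∀
  combine : ∀ {u₀ p x₃u₁ q x₆r s x₅v u₁ x₁u₂ x₅u₂ x₉u₃ x₆u₂ x₁₅u₃} →
    u₀ ≐ p ∷ x₃u₁ ∷ [] → p ≐ q ∷ x₆r ∷ [] → q ≐ s ∷ x₅v ∷ [] → s ≐ u₁ ∷ x₁u₂ ∷ [] →
    x₅v ≐ x₅u₂ ∷ x₉u₃ ∷ [] → x₆u₂ ≐ x₆r ∷ x₁₅u₃ ∷ [] →
    ⟦ u₀ ⟧ ⊕ ⟦ x₁₅u₃ ⟧ ≈ ⟦ u₁ ⟧ ⊕ ⟦ x₃u₁ ⟧ ⊕ ⟦ x₁u₂ ⟧ ⊕ ⟦ x₅u₂ ⟧ ⊕ ⟦ x₆u₂ ⟧ ⊕ ⟦ x₉u₃ ⟧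
  combine {x₃u₁ = f} {x₆r = e} {u₁ = a} {x₁u₂ = b} {x₅u₂ = c} {x₉u₃ = d} {x₁₅u₃ = g} p₁ p₂ p₃ p₄ p₅ p₆ m n
    rewrite at p₁ m n | at p₂ m n | at p₃ m n | at p₄ m n | at p₅ m n | at p₆ m n
    = lemma (⟦ a ⟧ m n) (⟦ b ⟧ m n) (⟦ c ⟧ m n) (⟦ d ⟧ m n) (⟦ e ⟧ m n) (⟦ f ⟧ m n) (⟦ g ⟧ m n)

1⊘ : ∀ g → g ≗ q^ 0 → q^ 0 ⊘ g ≗ q^ 0
1⊘ g p n = sym (⊘-unique (q^ 0) g (q^ 0) (p 0) (λ k → trans (⊗-congˡ (q^ 0) p k) (⊗-identityʳ (q^ 0) k)) n)

W≈U : W 0 ≈ U 0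
W≈U = QDifference-unique W U W-qDifference U-qDifference W-dilate (λ t → T-dilate t 3 5 1 3) constant
  where
  1⊗1 : ∀ f → f ≗ q^ 0 → f ⊗ q^ 0 ≗ q^ 0
  1⊗1 f p n = trans (⊗-identityʳ f n) (p n)
  constant : W 0 0 ≗ U 0 0
  constant n = cong₂ ℤ._+_
    (trans (ℤₚ.+-identityʳ _) (trans (1⊘ _ (1⊗1 (q^ 0) (λ _ → refl)) n)
      (sym (1⊘ _ (1⊗1 (q^ 0 ⊗ q^ 0 ⊗ q^ 0) (1⊗1 (q^ 0 ⊗ q^ 0) (1⊗1 (q^ 0) (λ _ → refl)))) n))))
    (↑-0 1 n)

-- Enumerations of sets of lists

-- Bare lists are enumerated, so that a part can be split off without carrying proofs along; the
-- count is an integer to match coefficients of series.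
record Enum (P : List ℕ → Set) (c : ℤ) : Set where
  field
    list      : List (List ℕ)
    distinct   : Unique list
    satisfies    : ∀ {xs} → xs ∈ list → P xs
    exhausts : ∀ {xs} → P xs → xs ∈ list
    count     : ℤ.+ length list ≡ c

open Enum

enum-∅ : ∀ {P} → (∀ {xs} → ¬ P xs) → Enum P 0ℤ
enum-∅ ¬P = record { list = [] ; distinct = [] ; satisfies = λ () ; exhausts = ⊥-elim ∘ ¬P ; count = refl }

enum-resp : ∀ {P Q c d} → (∀ {xs} → P xs → Q xs) → (∀ {xs} → Q xs → P xs) → c ≡ d → Enum P c → Enum Q d
enum-resp P⇒Q Q⇒P c≡d E = record
  { list = list E ; distinct = distinct E ; satisfies = P⇒Q ∘ satisfies E ; exhausts = exhausts E ∘ Q⇒P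
  ; count = trans (count E) c≡d }

enum-⊎ : ∀ {P Q c d} → (∀ {xs} → P xs → Q xs → ⊥) → Enum P c → Enum Q d →
         Enum (λ xs → P xs ⊎ Q xs) (c ℤ.+ d)
enum-⊎ disjoint E F = record
  { list     = list E ++ list F
  ; distinct   = Uniqueₚ.++⁺ (distinct E) (distinct F) (λ (e , f) → disjoint (satisfies E e) (satisfies F f))
  ; satisfies    = [ inj₁ ∘ satisfies E , inj₂ ∘ satisfies F ]′ ∘ ∈-++⁻ (list E)
  ; exhausts = [ ∈-++⁺ˡ ∘ exhausts E , ∈-++⁺ʳ (list E) ∘ exhausts F ]′
  ; count    = trans (cong ℤ.+_ (Listₚ.length-++ (list E))) (cong₂ ℤ._+_ (count E) (count F))
  }

Cons : ℕ → (List ℕ → Set) → List ℕ → Set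
Cons k P xs = ∃[ ys ] xs ≡ k ∷ ys × P ys

enum-∷ : ∀ k {P c} → Enum P c → Enum (Cons k P) c
enum-∷ k E = record
  { list     = List.map (k ∷_) (list E)
  ; distinct   = Uniqueₚ.map⁺ Listₚ.∷-injectiveʳ (distinct E)
  ; satisfies    = λ xs∈ → let (ys , ys∈ , eq) = ∈-map⁻ (k ∷_) xs∈ in ys , eq , satisfies E ys∈
  ; exhausts = λ { (ys , refl , p) → ∈-map⁺ (k ∷_) (exhausts E p) }
  ; count    = trans (cong ℤ.+_ (Listₚ.length-map (k ∷_) (list E))) (count E)
  }

At : (List ℕ → Set) → ℕ → ℕ → List ℕ → Set
At P m n xs = P xs × length xs ≡ m × sum xs ≡ n

↑-+ : ∀ k f n → (k ↑ f) (k + n) ≡ f n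
↑-+ zero    f n = refl
↑-+ (suc k) f n = ↑-+ k f n

-- Removing the first part shortens the list, so enumerations are required only for smaller lengths,
-- as strong induction on the number of parts provides.
enum-Cons : ∀ k {P F} m n → (∀ {m′} → m′ < m → ∀ n′ → Enum (At P m′ n′) (F m′ n′)) →
            Enum (At (Cons k P) m n) (mono 1 k F m n)
enum-Cons k zero n E = subst (Enum _) (sym (↑-0 k n)) (enum-∅ λ { ((_ , refl , _) , () , _) })
enum-Cons k {F = F} (suc m) n E with ℕₚ.<-≤-connex n k
... | inj₁ n<k = subst (Enum _) (sym (shift-< 0ℤ (F m) n<k))
  (enum-∅ λ { ((ys , refl , _) , _ , eq) → ℕₚ.<⇒≱ n<k (subst (k ≤_) eq (ℕₚ.m≤m+n k (sum ys))) })
... | inj₂ k≤n with ℕₚ.m≤n⇒∃[o]m+o≡n k≤n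
... | n′ , refl = enum-resp
  (λ { (ys , refl , p , refl , refl) → (ys , refl , p) , refl , refl })
  (λ { ((ys , refl , p) , refl , eq) → ys , refl , p , refl , ℕₚ.+-cancelˡ-≡ k _ _ eq })
  (sym (↑-+ k (F m) n′)) (enum-∷ k (E (ℕₚ.n<1+n m) n′))

-- Partitions in 𝒞 with bounded smallest part

-- Bounding the first part suffices, since lists linked by `Gap` increase.
Above : ℕ → List ℕ → Set
Above a []      = ⊤
Above a (x ∷ _) = a ≤ x

C≥ : ℕ → List ℕ → Set
C≥ a xs = Linked Gap xs × Above a xs

data GapView (a b : ℕ) : Set where
  two   : b ≡ 2 + a → 3 ∣ a + b → GapView a b
  three : b ≡ 3 + a → 3 ∣ a + b → GapView a b
  far   : 4 + a ≤ b → GapView a b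

Gap⇒≤ : ∀ {a b} → Gap a b → a ≤ b
Gap⇒≤ {a} {b} (2≤b∸a , _) = ℕₚ.<⇒≤ (ℕₚ.m∸n≢0⇒n<m (λ eq → ℕₚ.n≮0 (subst (1 <_) eq 2≤b∸a)))

gapView : ∀ a b → Gap a b → GapView a b
gapView a b g = go (b ∸ a) (ℕₚ.m∸n+n≡m (Gap⇒≤ {a} {b} g)) g
  where
  go : ∀ d → d + a ≡ b → 2 ≤ d × (d ≡ 2 ⊎ d ≡ 3 → 3 ∣ a + b) → GapView a b
  go 1                         eq (s≤s () , _)
  go 2                         eq (_ , 3∣) = two (sym eq) (3∣ (inj₁ refl))
  go 3                         eq (_ , 3∣) = three (sym eq) (3∣ (inj₂ refl))
  go (suc (suc (suc (suc d)))) eq _        = far (subst (4 + a ≤_) eq (s≤s (s≤s (s≤s (s≤s (ℕₚ.m≤n+m a d))))))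

gap-far : ∀ {a b} → 4 + a ≤ b → Gap a b
gap-far {a} {b} 4+a≤b =
  ℕₚ.≤-trans (s≤s (s≤s z≤n)) 4≤b∸a ,
  [ (λ eq → ⊥-elim (from-no (4 ℕₚ.≤? 2) (subst (4 ≤_) eq 4≤b∸a)))
  , (λ eq → ⊥-elim (from-no (4 ℕₚ.≤? 3) (subst (4 ≤_) eq 4≤b∸a))) ]′
  where
  4≤b∸a : 4 ≤ b ∸ a
  4≤b∸a = subst (_≤ b ∸ a) (ℕₚ.m+n∸n≡m 4 a) (ℕₚ.∸-monoˡ-≤ a 4+a≤b)

gap-near : ∀ e a → 3 ∣ a + (2 + e + a) → Gap a (2 + e + a)
gap-near e a 3∣ = subst (2 ≤_) (sym (ℕₚ.m+n∸n≡m (2 + e) a)) (s≤s (s≤s z≤n)) , λ _ → 3∣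

-- Modulo 3 the multiples of t drop out, so every divisibility question about adjacent parts becomes
-- one about numerals, settled by computation.
regroup : ∀ r s t → (r + t * 3) + (s + (r + t * 3)) ≡ (t + t) * 3 + (r + (s + r))
regroup = ℕ-Solver.solve-∀

3∣-drop : ∀ r s t → 3 ∣ (r + t * 3) + (s + (r + t * 3)) → 3 ∣ r + (s + r)
3∣-drop r s t 3∣ = ∣m+n∣m⇒∣n (subst (3 ∣_) (regroup r s t) 3∣) (n∣m*n (t + t))

3∣-add : ∀ r s t → 3 ∣ r + (s + r) → 3 ∣ (r + t * 3) + (s + (r + t * 3))
3∣-add r s t 3∣ = subst (3 ∣_) (sym (regroup r s t)) (∣m∣n⇒∣m+n (n∣m*n (t + t)) 3∣)

far-∷ : ∀ a {ys} → C≥ (4 + a) ys → Linked Gap (a ∷ ys)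
far-∷ a {[]}     _             = [-]
far-∷ a {y ∷ ys} (linked , le) = gap-far le ∷ linked

after : ℕ → List ℕ → Set
after a ys = Linked Gap (a ∷ ys)

after₁ : ∀ t → C≥ (5 + t * 3) ⇔ after (1 + t * 3)
after₁ t .proj₁           = far-∷ (1 + t * 3)
after₁ t .proj₂ [-]     = [] , tt
after₁ t .proj₂ {y ∷ _} (g ∷ l) with gapView (1 + t * 3) y g
... | two refl 3∣   = ⊥-elim (from-no (3 ∣? 4) (3∣-drop 1 2 t 3∣))
... | three refl 3∣ = ⊥-elim (from-no (3 ∣? 5) (3∣-drop 1 3 t 3∣))
... | far le        = l , le

-- The residue 2 admits a gap of 2. The next part is then 3(t + 1) + 1, so `after₁` governs what
-- comes after it.
after₂ : ∀ t → (λ ys → C≥ (6 + t * 3) ys ⊎ Cons (4 + t * 3) (C≥ (8 + t * 3)) ys) ⇔ after (2 + t * 3)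
after₂ t .proj₁ (inj₁ c)             = far-∷ (2 + t * 3) c
after₂ t .proj₁ (inj₂ (_ , refl , c)) = gap-near 0 (2 + t * 3) (3∣-add 2 2 t (from-yes (3 ∣? 6))) ∷ proj₁ (after₁ (suc t)) c
after₂ t .proj₂ [-]     = inj₁ ([] , tt)
after₂ t .proj₂ {y ∷ _} (g ∷ l) with gapView (2 + t * 3) y g
... | two refl 3∣   = inj₂ (_ , refl , proj₂ (after₁ (suc t)) l)
... | three refl 3∣ = ⊥-elim (from-no (3 ∣? 7) (3∣-drop 2 3 t 3∣))
... | far le        = inj₁ (l , le)

-- The residue 0 admits a gap of 3, which fills the place just below the gaps of at least 4, so the
-- admissible continuations form a single range.
after₃ : ∀ t → C≥ (6 + t * 3) ⇔ after (3 + t * 3)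
after₃ t .proj₁ {[]}     _        = [-]
after₃ t .proj₁ {y ∷ ys} (l , le) with ℕₚ.m≤n⇒m<n∨m≡n le
... | inj₁ lt   = gap-far lt ∷ l
... | inj₂ refl = gap-near 1 (3 + t * 3) (3∣-add 3 3 t (from-yes (3 ∣? 9))) ∷ l
after₃ t .proj₂ [-]     = [] , tt
after₃ t .proj₂ {y ∷ _} (g ∷ l) with gapView (3 + t * 3) y g
... | two refl 3∣   = ⊥-elim (from-no (3 ∣? 8) (3∣-drop 3 2 t 3∣))
... | three refl 3∣ = l , ℕₚ.≤-refl
... | far le        = l , ℕₚ.<⇒≤ le

C≥-weaken : ∀ {a xs} → C≥ (suc a) xs → C≥ a xs
C≥-weaken {xs = []}    (l , _)  = l , tt
C≥-weaken {xs = _ ∷ _} (l , le) = l , ℕₚ.<⇒≤ le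

enum-C≥ : ∀ {a P F G m n} → P ⇔ after a →
  Enum (At (C≥ (suc a)) m n) (F m n) →
  (∀ {m′} → m′ < m → ∀ n′ → Enum (At P m′ n′) (G m′ n′)) →
  Enum (At (C≥ a) m n) ((F ⊕ mono 1 a G) m n)
enum-C≥ {a} {P} {m = m} {n} P⇔after E E′ = enum-resp join split refl (enum-⊎ disjoint E (enum-Cons a m n E′))
  where
  disjoint : ∀ {xs} → At (C≥ (suc a)) m n xs → At (Cons a P) m n xs → ⊥
  disjoint ((_ , lt) , _) ((_ , refl , _) , _) = ℕₚ.<-irrefl refl lt
  join : ∀ {xs} → At (C≥ (suc a)) m n xs ⊎ At (Cons a P) m n xs → At (C≥ a) m n xs
  join (inj₁ (c , at))              = C≥-weaken c , at
  join (inj₂ ((_ , refl , p) , at)) = (proj₁ P⇔after p , ℕₚ.≤-refl) , at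
  split : ∀ {xs} → At (C≥ a) m n xs → At (C≥ (suc a)) m n xs ⊎ At (Cons a P) m n xs
  split {[]}     ((l , _) , at)  = inj₁ ((l , tt) , at)
  split {x ∷ xs} ((l , le) , at) with ℕₚ.m≤n⇒m<n∨m≡n le
  ... | inj₁ lt   = inj₁ ((l , lt) , at)
  ... | inj₂ refl = inj₂ ((xs , refl , proj₂ P⇔after l) , at)

F : ℕ → ℤ⟦x,q⟧
F t = G t ⊕ mono 1 (1 + t * 3) (G (1 + t))

Counted : (ℕ → List ℕ → Set) → (ℕ → ℤ⟦x,q⟧) → ℕ → Set
Counted P X m = ∀ t n → Enum (At (P t) m n) (X t m n)

enum-[] : ∀ a n → Enum (At (C≥ a) 0 n) ((q^ 0) n)
enum-[] a zero    = record
  { list = [] ∷ [] ; distinct = [] ∷ [] ; satisfies = λ { (here refl) → ([] , tt) , refl , refl }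
  ; exhausts = λ { {[]} _ → here refl ; {_ ∷ _} (_ , () , _) } ; count = refl }
enum-[] a (suc n) = enum-∅ λ { {[]} (_ , _ , ()) ; {_ ∷ _} (_ , () , _) }

S-constant : ∀ a b → S a b 0 ≗ q^ 0
S-constant a b n = trans (ℤₚ.+-identityʳ _) (trans
  (cong (λ e → (e ↑ recip₂ (0 , 0)) n) (lemma a b))
  (1⊘ (q^ 0 ⊗ q^ 0) (⊗-identityʳ (q^ 0)) n))
  where
  lemma : ∀ a b → a * 0 + b * 0 ≡ 0
  lemma = ℕ-Solver.solve-∀

H-small : ∀ t m n → n < t * 3 → H t (suc m) n ≡ 0ℤ
H-small t m n n<3t = trans (cong₂ (λ a b → S a b (suc m) n) (ℕₚ.+-comm 1 (t * 3)) (ℕₚ.+-comm 3 (t * 6)))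
  (trans (S-dilate t 1 3 (suc m) n)
    (shift-< 0ℤ (S 1 3 (suc m)) (ℕₚ.≤-trans n<3t (ℕₚ.m≤m+n (t * 3) (m * (t * 3))))))

-- Below q^(3t) both sides see only the empty list: a part would exceed n, and in `H t` every
-- positive power of x brings a factor q^(3t).
H-base : ∀ m t n → n < t * 3 → Enum (At (C≥ (3 + t * 3)) m n) (H t m n)
H-base zero    t n n<3t = subst (Enum _) (sym (S-constant (1 + t * 3) (3 + t * 6) n)) (enum-[] (3 + t * 3) n)
H-base (suc m) t n n<3t = subst (Enum _) (sym (H-small t m n n<3t)) (enum-∅ λ
  { {_ ∷ xs} ((_ , le) , _ , refl) →
      ℕₚ.<⇒≱ n<3t (ℕₚ.≤-trans (ℕₚ.m≤n+m (t * 3) 3) (ℕₚ.≤-trans le (ℕₚ.m≤m+n _ (sum xs)))) })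

-- With m parts fixed, the three passages below go from `H (1 + t)` back to `H t`; all terms with a
-- factor x are covered by the hypotheses on fewer parts.
module _ (m : ℕ) (G-below : ∀ {m′} → m′ < m → Counted (λ t → C≥ (2 + t * 3)) G m′)
                 (H-below : ∀ {m′} → m′ < m → Counted (λ t → C≥ (3 + t * 3)) H m′) where

  G-from-H : ∀ t n → Enum (At (C≥ (3 + t * 3)) m n) (H t m n) → Enum (At (C≥ (2 + t * 3)) m n) (G t m n)
  G-from-H t n E = subst (Enum _) value≡
    (enum-C≥ {F = H t} {G = H (1 + t) ⊕ mono 1 (4 + t * 3) (G (2 + t))} (after₂ t) E λ {m′} m′<m n′ →
      enum-resp [ (λ (p , at) → inj₁ p , at) , (λ (p , at) → inj₂ p , at) ]′
                (λ { (inj₁ p , at) → inj₁ (p , at) ; (inj₂ p , at) → inj₂ (p , at) }) refl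
        (enum-⊎ (λ { ((_ , le) , _) ((_ , refl , _) , _) → ℕₚ.<⇒≱ (ℕₚ.m<n+m (4 + t * 3) {2} (s≤s z≤n)) le })
          (H-below m′<m (1 + t) n′)
          (enum-Cons (4 + t * 3) m′ n′ (λ m″<m′ → G-below (ℕₚ.<-trans m″<m′ m′<m) (2 + t)))))
    where
    expo : ∀ t → 2 + t * 3 + (4 + t * 3) ≡ 6 + t * 6
    expo = ℕ-Solver.solve-∀
    value≡ : H t m n ℤ.+ mono 1 (2 + t * 3) (H (1 + t) ⊕ mono 1 (4 + t * 3) (G (2 + t))) m n ≡ G t m n
    value≡ = trans (cong (ℤ._+_ (H t m n)) (trans
      (mono-⊕ 1 (2 + t * 3) (H (1 + t)) (mono 1 (4 + t * 3) (G (2 + t))) m n)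
      (cong (ℤ._+_ (mono 1 (2 + t * 3) (H (1 + t)) m n)) (trans
        (mono-mono 1 (2 + t * 3) 1 (4 + t * 3) (G (2 + t)) m n)
        (trans (cong (λ k → mono 2 k (G (2 + t)) m n) (expo t)) (sym (ℤₚ.+-identityʳ _)))))))
      (sym (at (G-rec t) m n))

  F-from-G : ∀ t n → Enum (At (C≥ (2 + t * 3)) m n) (G t m n) → Enum (At (C≥ (1 + t * 3)) m n) (F t m n)
  F-from-G t n E = enum-C≥ {F = G t} {G = G (1 + t)} (after₁ t) E (λ m′<m → G-below m′<m (1 + t))

  H-from-F : ∀ t n → Enum (At (C≥ (4 + t * 3)) m n) (F (1 + t) m n) → Enum (At (C≥ (3 + t * 3)) m n) (H t m n)
  H-from-F t n E = subst (Enum _) (trans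
      (lemma (G (1 + t) m n) (mono 1 (4 + t * 3) (G (2 + t)) m n) (mono 1 (3 + t * 3) (H (1 + t)) m n))
      (sym (at (H-rec t) m n)))
    (enum-C≥ {F = F (1 + t)} {G = H (1 + t)} (after₃ t) E (λ m′<m → H-below m′<m (1 + t)))
    where
    lemma : ∀ x y z → x ℤ.+ y ℤ.+ z ≡ x ℤ.+ (y ℤ.+ (z ℤ.+ 0ℤ))
    lemma = ℤ-Solver.solve-∀

  H-counted : Counted (λ t → C≥ (3 + t * 3)) H m
  H-counted t n = go (suc n) t n (ℕₚ.≤-trans (ℕₚ.m≤n+m (suc n) t) (ℕₚ.m≤m*n (t + suc n) 3))
    where
    -- All parts exceed 3 t, so the recursion on t stops once 3 t > n.
    go : ∀ d t n → n < (t + d) * 3 → Enum (At (C≥ (3 + t * 3)) m n) (H t m n)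
    go zero    t n n< = H-base m t n (subst (λ k → n < k * 3) (ℕₚ.+-identityʳ t) n<)
    go (suc d) t n n< = H-from-F t n (F-from-G (1 + t) n (G-from-H (1 + t) n
      (go d (1 + t) n (subst (λ k → n < k * 3) (ℕₚ.+-suc t d) n<))))

GH-counted : ∀ m → Counted (λ t → C≥ (2 + t * 3)) G m × Counted (λ t → C≥ (3 + t * 3)) H m
GH-counted = <-rec _ λ m below →
  let H-m = H-counted m (proj₁ ∘ below) (proj₂ ∘ below)
  in (λ t n → G-from-H m (proj₁ ∘ below) (proj₂ ∘ below) t n (H-m t n)) , H-m

W-enum : ∀ m n → Enum (λ xs → At (C≥ 3) m n xs ⊎ At (Cons 1 (C≥ 5)) m n xs) (W 0 m n)
W-enum m n = enum-⊎ (λ { ((_ , le) , _) ((_ , refl , _) , _) → ℕₚ.<⇒≱ (s≤s (s≤s z≤n)) le })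
  (proj₂ (GH-counted m) 0 n) (enum-Cons 1 m n (λ {m′} _ → proj₁ (GH-counted m′) 1))

-- From enumerated lists to sums over partitions

weight : Partition → ℤ⟦x,q⟧
weight π = x^ ℓ π · q^ ∣ π ∣ₚ

weight-≡ : ∀ π {m n} → ℓ π ≡ m → ∣ π ∣ₚ ≡ n → weight π m n ≡ 1ℤ
weight-≡ π {m} {n} p r = trans (x^-≡ m (ℓ π) (q^ ∣ π ∣ₚ) n (sym p))
  (cong (if_then 1ℤ else 0ℤ) (dec-true (n ≟ ∣ π ∣ₚ) (sym r)))

weight-≢ : ∀ π {m n} → ¬ (ℓ π ≡ m × ∣ π ∣ₚ ≡ n) → weight π m n ≡ 0ℤ
weight-≢ π {m} {n} p with ℓ π ≟ m
... | no ≢ = x^-≢ m (ℓ π) (q^ ∣ π ∣ₚ) n (≢ ∘ sym)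
... | yes eq = trans (x^-≡ m (ℓ π) (q^ ∣ π ∣ₚ) n (sym eq))
  (cong (if_then 1ℤ else 0ℤ) (dec-false (n ≟ ∣ π ∣ₚ) (λ r → p (eq , sym r))))

module _ {Q : Partition → Set} {P : List ℕ → Set}
         (to-Q : ∀ {xs} → P xs → Σ[ pos ∈ All (0 <_) xs ] Σ[ inc ∈ Linked _≤_ xs ] Q (mkPartition xs pos inc))
         (from-Q : ∀ {xs} (pos : All (0 <_) xs) (inc : Linked _≤_ xs) → Q (mkPartition xs pos inc) → P xs) where

  private
    I : Set
    I = [ π ∈ Partition ∣ Q π ]

    key : I → List ℕ
    key = parts ∘ value

    key-injective : ∀ {i j} → key i ≡ key j → i ≡ j
    key-injective {mkPartition _ _ _ , _} {mkPartition _ _ _ , _} refl = refl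

    build : ∀ {L} → All P L → List I
    build []       = []
    build (p ∷ ps) = let (pos , inc , r) = to-Q p in (mkPartition _ pos inc , [ r ]) ∷ build ps

    keys-build : ∀ {L} (ps : All P L) → List.map key (build ps) ≡ L
    keys-build []       = refl
    keys-build (p ∷ ps) = cong (_ ∷_) (keys-build ps)

    ∈-build : ∀ {L} (ps : All P L) {i} → key i ∈ L → i ∈ build ps
    ∈-build ps {i} k∈ with ∈-map⁻ key (subst (key i ∈_) (sym (keys-build ps)) k∈)
    ... | j , j∈ , eq = subst (_∈ build ps) (sym (key-injective eq)) j∈

    total-build : ∀ {m n L} (ps : All P L) → All (λ xs → length xs ≡ m × sum xs ≡ n) L →
                  total (build ps) (λ i → weight (value i) m n) ≡ ℤ.+ length L
    total-build []       []              = refl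
    total-build (p ∷ ps) ((eq , eq′) ∷ at) = let (pos , inc , _) = to-Q p in
      cong₂ ℤ._+_ (weight-≡ (mkPartition _ pos inc) eq eq′) (total-build ps at)

  partitions-hasSum : ∀ S → (∀ m n → Enum (At P m n) (S m n)) → HasSum {I} (weight ∘ value) S
  partitions-hasSum S E m n = build ps , uniq , outside ,
    trans (total-build ps (All.tabulate (proj₂ ∘ satisfies (E m n)))) (count (E m n))
    where
    ps : All P (list (E m n))
    ps = All.tabulate (proj₁ ∘ satisfies (E m n))
    uniq : Unique (build ps)
    uniq = Uniqueₚ.map⁻ {f = key} (subst Unique (sym (keys-build ps)) (distinct (E m n)))
    open DecMembership (Listₚ.≡-dec _≟_) using (_∈?_)
    outside : ∀ i → i ∉ build ps → weight (value i) m n ≡ 0ℤ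
    outside i@(mkPartition xs pos inc , [ r ]) i∉ = weight-≢ (value i) λ at → xs∉ at (xs ∈? list (E m n))
      where
      xs∉ : length xs ≡ m × sum xs ≡ n → Dec (xs ∈ list (E m n)) → ⊥
      xs∉ at (yes xs∈) = i∉ (∈-build ps xs∈)
      -- The proofs stored in a refined partition are irrelevant and cannot produce membership. Once
      -- membership is decided, they are needed only for a contradiction, where irrelevance is
      -- harmless.
      xs∉ at (no  ∉L)  = ⊥-elim-irr (∉L (exhausts (E m n) (from-Q pos inc r , at)))

Above⇒∉ : ∀ {a b xs} → a < b → C≥ b xs → a ∉ xs
Above⇒∉ a<b (_       , le) (here refl) = ℕₚ.<⇒≱ a<b le
Above⇒∉ a<b ([-]     , le) (there ())
Above⇒∉ {xs = x ∷ y ∷ _} a<b (g ∷ l , le) (there a∈) = Above⇒∉ a<b (l , ℕₚ.≤-trans le (Gap⇒≤ {x} {y} g)) a∈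

Above⇒positive : ∀ {a xs} → C≥ (suc a) xs → All (0 <_) xs
Above⇒positive {xs = []}         c            = []
Above⇒positive {xs = x ∷ []}     (l , le)     = ℕₚ.≤-trans (s≤s z≤n) le ∷ []
Above⇒positive {xs = x ∷ y ∷ xs} (g ∷ l , le) =
  ℕₚ.≤-trans (s≤s z≤n) le ∷ Above⇒positive (l , ℕₚ.≤-trans le (Gap⇒≤ {x} {y} g))

𝒞⇒increasing : ∀ {xs} → Linked Gap xs → Linked _≤_ xs
𝒞⇒increasing = Linked.map λ {x} {y} → Gap⇒≤ {x} {y}

𝒫₁-hasSum : HasSum {𝒫₁} (weight ∘ value) (G 0)
𝒫₁-hasSum = partitions-hasSum {P = C≥ 2}
  (λ c → Above⇒positive c , 𝒞⇒increasing (proj₁ c) , proj₁ c , Above⇒∉ ℕₚ.≤-refl c)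
  from-𝒫₁ (G 0) (λ m → proj₁ (GH-counted m) 0)
  where
  from-𝒫₁ : ∀ {xs} → All (0 <_) xs → Linked _≤_ xs → Linked Gap xs × 1 ∉ xs → C≥ 2 xs
  from-𝒫₁ {[]}         _         _ (l , _)   = l , tt
  from-𝒫₁ {x ∷ xs} (pos ∷ _) _ (l , 1∉) = l , ℕₚ.≤∧≢⇒< pos (λ 1≡x → 1∉ (here 1≡x))

𝒫₂-hasSum : HasSum {𝒫₂} (weight ∘ value) (W 0)
𝒫₂-hasSum = partitions-hasSum {P = λ xs → C≥ 3 xs ⊎ Cons 1 (C≥ 5) xs}
  to-𝒫₂ from-𝒫₂ (W 0) λ m n → enum-resp
    [ (λ (p , at) → inj₁ p , at) , (λ (p , at) → inj₂ p , at) ]′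
    (λ { (inj₁ p , at) → inj₁ (p , at) ; (inj₂ p , at) → inj₂ (p , at) }) refl (W-enum m n)
  where
  to-𝒫₂ : ∀ {xs} → C≥ 3 xs ⊎ Cons 1 (C≥ 5) xs →
          Σ[ pos ∈ All (0 <_) xs ] Σ[ inc ∈ Linked _≤_ xs ] (Linked Gap xs × 2 ∉ xs)
  to-𝒫₂ (inj₁ c) = Above⇒positive c , 𝒞⇒increasing (proj₁ c) , proj₁ c , Above⇒∉ ℕₚ.≤-refl c
  to-𝒫₂ (inj₂ (_ , refl , c)) =
    ℕₚ.≤-refl ∷ Above⇒positive c , 𝒞⇒increasing l , l ,
    λ { (there 2∈) → Above⇒∉ (s≤s (s≤s (s≤s z≤n))) c 2∈ }
    where l = proj₁ (after₁ 0) c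
  from-𝒫₂ : ∀ {xs} → All (0 <_) xs → Linked _≤_ xs → Linked Gap xs × 2 ∉ xs → C≥ 3 xs ⊎ Cons 1 (C≥ 5) xs
  from-𝒫₂ {[]}           _         _ (l , _)  = inj₁ (l , tt)
  from-𝒫₂ {zero ∷ xs}    (() ∷ _)
  from-𝒫₂ {1 ∷ xs}       _         _ (l , _)  = inj₂ (xs , refl , proj₂ (after₁ 0) l)
  from-𝒫₂ {suc (suc x) ∷ xs} _     _ (l , 2∉) =
    inj₁ (l , s≤s (s≤s (ℕₚ.n≢0⇒n>0 (λ { refl → 2∉ (here refl) }))))

-- The multiple sums of the theorem

hasSum-resp : ∀ {I} {F F′ : I → ℤ⟦x,q⟧} {S S′} →
              (∀ i → F i ≈ F′ i) → S ≈ S′ → HasSum F S → HasSum F′ S′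
hasSum-resp F≈F′ S≈S′ h m n = let (L , uniq , outside , eq) = h m n in
  L , uniq , (λ i i∉ → trans (sym (F≈F′ i m n)) (outside i i∉)) ,
  trans (total-cong L (λ {i} _ → sym (F≈F′ i m n))) (trans eq (S≈S′ m n))

x^-cong : ∀ {a b f g} → a ≡ b → f ≗ g → x^ a · f ≈ x^ b · g
x^-cong {a} {f = f} {g} refl p m n = by-cases (m ≟ a)
  where
  by-cases : Dec (m ≡ a) → (x^ a · f) m n ≡ (x^ a · g) m n
  by-cases (yes eq) = trans (x^-≡ m a f n eq) (trans (p n) (sym (x^-≡ m a g n eq)))
  by-cases (no  ne) = trans (x^-≢ m a f n ne) (sym (x^-≢ m a g n ne))

quotient : ∀ {e e′} g → g 0 ≡ 1ℤ → e ≡ e′ → e ↑ (q^ 0 ⊘ g) ≗ q^ e′ ⊘ g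
quotient {e} g g₀≡1 refl n = sym (q^⊘ e g g₀≡1 n)

suc-weighting : ∀ {I wt} → Weighting {I} wt → Weighting (λ i → wt i + 1)
suc-weighting {I} {wt} Wt = record
  { solutions = sols ; unique = uniq ; sound = λ {m} → snd m
  ; complete = λ i → subst (λ m → i ∈ sols m) (ℕₚ.+-comm 1 (wt i)) (complete Wt i) }
  where
  sols : ℕ → List I
  sols zero    = []
  sols (suc m) = solutions Wt m
  uniq : ∀ m → Unique (sols m)
  uniq zero    = []
  uniq (suc m) = unique Wt m
  snd : ∀ m {i} → i ∈ sols m → wt i + 1 ≡ m
  snd (suc m) {i} i∈ = trans (ℕₚ.+-comm (wt i) 1) (cong suc (sound Wt i∈))

series-suc : ∀ {I wt} (Wt : Weighting {I} wt) (V : I → ℤ⟦q⟧) β (e : I → ℕ) →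
  series (suc-weighting Wt) (λ i → (β + e i) ↑ V i) ≈ mono 1 β (series Wt (λ i → e i ↑ V i))
series-suc Wt V β e zero    n = sym (↑-0 β n)
series-suc Wt V β e (suc m) n = trans
  (total-cong (solutions Wt m) (λ {i} _ → sym (shift-+ 0ℤ β (e i) (V i) n)))
  (sym (total-↑ β (solutions Wt m) (λ i → e i ↑ V i) n))

-- Passing from `S 1 3` to `S 1 0` gains x² q⁶ `S 7 12`, and passing from x q `S 3 6` to x q `S 4 6`
-- loses the same term.
W-split : W 0 ≈ S 1 0 ⊕ mono 1 1 (S 4 6)
W-split = combine (S-step₂ 1 0) (scaled 1 1 (S-step₁ 3 6))
  where
  lemma : ∀ x y z → x ℤ.+ (y ℤ.+ (z ℤ.+ 0ℤ)) ≡ x ℤ.+ (z ℤ.+ 0ℤ) ℤ.+ y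
  lemma = ℤ-Solver.solve-∀
  combine : ∀ {s h z xg xs} → s ≐ h ∷ z ∷ [] → xg ≐ xs ∷ z ∷ [] → ⟦ h ⟧ ⊕ ⟦ xg ⟧ ≈ ⟦ s ⟧ ⊕ ⟦ xs ⟧
  combine {h = h} {z} {xs = xs} p₁ p₂ m n rewrite at p₁ m n | at p₂ m n = lemma (⟦ h ⟧ m n) (⟦ xs ⟧ m n) (⟦ z ⟧ m n)

sum₁ : HasSum (λ (i , j) → x^ (i + 2 * j) · (q^ (2 * (i * i) + 6 * (i * j) + 6 * (j * j)) ⊘ denom₂ (i , j))) (G 0)
sum₁ = hasSum-resp (λ p@(i , j) → x^-cong refl (quotient (denom₂ p) (denom₂-unit p)
    (trans (ℕₚ.+-identityʳ _) (ℕₚ.+-identityʳ _))))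
  (λ _ _ → refl) (hasSum pairs (λ p → expo₂ 0 0 p ↑ recip₂ p))

sumA : HasSum (λ (i , j) → x^ (i + 2 * j) · (q^ (2 * (i * i) + 6 * (i * j) + 6 * (j * j) + i) ⊘ denom₂ (i , j))) (S 1 0)
sumA = hasSum-resp (λ p@(i , j) → x^-cong refl (quotient (denom₂ p) (denom₂-unit p) (lemma i j)))
  (λ _ _ → refl) (hasSum pairs (λ p → expo₂ 1 0 p ↑ recip₂ p))
  where
  lemma : ∀ i j → 2 * (i * i) + 6 * (i * j) + 6 * (j * j) + 1 * i + 0 * j ≡ 2 * (i * i) + 6 * (i * j) + 6 * (j * j) + i
  lemma = ℕ-Solver.solve-∀

sumB : HasSum (λ (i , j) → x^ (i + 2 * j + 1) ·
         (q^ (2 * (i * i) + 6 * (i * j) + 6 * (j * j) + 4 * i + 6 * j + 1) ⊘ denom₂ (i , j))) (mono 1 1 (S 4 6))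
sumB = hasSum-resp (λ p@(i , j) → x^-cong refl (quotient (denom₂ p) (denom₂-unit p) (ℕₚ.+-comm 1 _)))
  (series-suc pairs recip₂ 1 (expo₂ 4 6)) (hasSum (suc-weighting pairs) (λ p → (1 + expo₂ 4 6 p) ↑ recip₂ p))

sum₄ : HasSum (λ (i , j , k , l) → let R = i + j + k + 2 * l in
         x^ R · (q^ (3 * R * (R ∸ 1) / 2 + 3 * i + 5 * j + 3 * j * (j ∸ 1) / 2 + k + 3 * k * (k ∸ 1) / 2 + 3 * l)
                   ⊘ denom₄ (i , j , k , l))) (W 0)
sum₄ = hasSum-resp (λ p@(i , j , k , l) → x^-cong (weight≡ i j k l)
    (quotient (denom₄ p) (denom₄-unit p) (expo≡ i j k l)))
  (λ m n → sym (W≈U m n)) (hasSum quads (λ p → expo₄ 3 5 1 3 p ↑ recip₄ p))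
  where
  weight≡ : ∀ i j k l → i + (j + (k + 2 * l)) ≡ i + j + k + 2 * l
  weight≡ = ℕ-Solver.solve-∀
  lemma : ∀ i j k l r s t → 3 * r + 3 * i + (5 * j + 3 * s) + (1 * k + 3 * t) + 3 * l
                          ≡ 3 * r + 3 * i + 5 * j + 3 * s + k + 3 * t + 3 * l
  lemma = ℕ-Solver.solve-∀
  expo≡ : ∀ i j k l → let R = i + j + k + 2 * l in expo₄ 3 5 1 3 (i , j , k , l) ≡
    3 * R * (R ∸ 1) / 2 + 3 * i + 5 * j + 3 * j * (j ∸ 1) / 2 + k + 3 * k * (k ∸ 1) / 2 + 3 * l
  expo≡ i j k l rewrite 3n[n∸1]/2 (i + j + k + 2 * l) | 3n[n∸1]/2 j | 3n[n∸1]/2 k | weight≡ i j k l =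
    lemma i j k l (tri (i + j + k + 2 * l)) (tri j) (tri k)

mainTheorem13 : (∃[ S ]
    HasSum {𝒫₁} (λ π → x^ ℓ (value π) · q^ ∣ value π ∣ₚ) S
    × HasSum {ℕ × ℕ}
    (λ (i , j) →
    x^ (i + 2 * j) ·
    (q^ (2 * (i * i) + 6 * (i * j) + 6 * (j * j))
    ⊘ (⟨ q^ 1 ⨾ q^ 1 ⟩ i ⊗ ⟨ q^ 3 ⨾ q^ 3 ⟩ j)))
    S)
    ×
    (∃[ S ]
    HasSum {𝒫₂} (λ π → x^ ℓ (value π) · q^ ∣ value π ∣ₚ) S
    × HasSum {ℕ × ℕ × ℕ × ℕ}
    (λ (i , j , k , l) → let R = i + j + k + 2 * l in
    x^ R ·
    (q^ (3 * R * (R ∸ 1) / 2 + 3 * i + 5 * j + 3 * j * (j ∸ 1) / 2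
    + k + 3 * k * (k ∸ 1) / 2 + 3 * l)
    ⊘ (⟨ q^ 3 ⨾ q^ 3 ⟩ i ⊗ ⟨ q^ 3 ⨾ q^ 3 ⟩ j
    ⊗ ⟨ q^ 3 ⨾ q^ 3 ⟩ k ⊗ ⟨ q^ 6 ⨾ q^ 6 ⟩ l)))
    S
    × (∃[ A ] ∃[ B ]
    HasSum {ℕ × ℕ}
    (λ (i , j) →
    x^ (i + 2 * j) ·
    (q^ (2 * (i * i) + 6 * (i * j) + 6 * (j * j) + i)
    ⊘ (⟨ q^ 1 ⨾ q^ 1 ⟩ i ⊗ ⟨ q^ 3 ⨾ q^ 3 ⟩ j)))
    A
    × HasSum {ℕ × ℕ}
    (λ (i , j) →
    x^ (i + 2 * j + 1) ·
    (q^ (2 * (i * i) + 6 * (i * j) + 6 * (j * j) + 4 * i + 6 * j + 1)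
    ⊘ (⟨ q^ 1 ⨾ q^ 1 ⟩ i ⊗ ⟨ q^ 3 ⨾ q^ 3 ⟩ j)))
    B
    × S ≈ A ⊕ B))
mainTheorem13 =
  (G 0 , 𝒫₁-hasSum , sum₁) ,
  (W 0 , 𝒫₂-hasSum , sum₄ , S 1 0 , mono 1 1 (S 4 6) , sumA , sumB , W-split)
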